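{- Let $\dot G$ be a signed graph with spectrum $\{[-\lambda]^{m-2},[-1]^1,[1]^1,[\lambda]^{m-2}\}$. Suppose every vertex of its underlying graph $G$ has degree $\lambda^2$, $\lambda^2-1$, or $\lambda^2-2$, and at least one vertex has degree $\lambda^2-1$. Then there is a signed graph $\dot H$ with spectrum $\{[-\lambda]^{m-1},[0]^1,[\lambda]^{m-1}\}$, all of whose vertices have degree $\lambda^2$ or $\lambda^2-1$, containing a vertex whose deletion yields $\dot G$.
   Context: A signed graph $\dot G=(G,\sigma)$ consists of a simple graph $G$ and $\sigma:E(G)\to\{1,-1\}$; its adjacency matrix is that of $G$ with entries of negative edges replaced by $-1$, and its spectrum is the multiset of eigenvalues of this matrix. The degree of a vertex is its degree in the underlying graph. The notation $[\mu]^k$ means eigenvalue $\mu$ with multiplicity $k$. -}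

module Defs where

open import Data.Nat using (ℕ; zero; suc)
open import Data.Integer using (ℤ; +_; -[1+_]; _+_; _*_; -_; _-_; _^_)
open import Data.Fin using (Fin; zero; suc; punchIn)
open import Data.List using (List; length; filter)
open import Data.Integer.Properties using (_≟_)
open import Relation.Nullary using (¬?)
open import Relation.Binary.PropositionalEquality using (_≡_)
open import Data.Sum using (_⊎_)
open import Data.Product using (_×_)
import Data.List as L
import Data.Fin as F

Matrix : ℕ → Set
Matrix n = Fin n → Fin n → ℤ

Σ-Fin : ∀ n → (Fin n → ℤ) → ℤ
Σ-Fin zero    f = + 0
Σ-Fin (suc n) f = f zero + Σ-Fin n (λ i → f (suc i))

sgn : ℕ → ℤ
sgn zero          = + 1
sgn (suc zero)    = -[1+ 0 ]
sgn (suc (suc k)) = sgn k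

det : ∀ n → Matrix n → ℤ
det zero    M = + 1
det (suc n) M =
  Σ-Fin (suc n) (λ j → sgn (F.toℕ j) * (M zero j * det n (λ a b → M (suc a) (punchIn j b))))

charPoly : ∀ {n} → Matrix n → ℤ → ℤ
charPoly {n} M x = det n (λ i j → δ i j - M i j)
  where
  δ : Fin n → Fin n → ℤ
  δ i j with i F.≟ j
  ... | Relation.Nullary.yes _ = x
  ... | Relation.Nullary.no  _ = + 0

record SignedGraph (n : ℕ) : Set where
  field
    adj      : Matrix n
    entries  : ∀ i j → adj i j ≡ + 0 ⊎ adj i j ≡ + 1 ⊎ adj i j ≡ -[1+ 0 ]
    symm     : ∀ i j → adj i j ≡ adj j i
    loopless : ∀ i → adj i i ≡ + 0
open SignedGraph public

degree : ∀ {n} → SignedGraph n → Fin n → ℕ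
degree {n} G i = length (filter (λ j → ¬? (adj G i j ≟ + 0)) (L.allFin n))

-- The spectrum of a signed graph, as a multiset, is determined by (and
-- determines) its characteristic polynomial: the spectrum is
-- {[μ_1]^{k_1},...,[μ_r]^{k_r}} iff charPoly = ∏ (x - μ_i)^{k_i}.
-- Spectrum {[-λ]^j, [-1]^1, [1]^1, [λ]^j} with λ² = k:
HasSpectrumG : ∀ {n} → SignedGraph n → (k j : ℕ) → Set
HasSpectrumG G k j = ∀ x → charPoly (adj G) x ≡ ((x * x - + k) ^ j) * (x * x - + 1)

-- Spectrum {[-λ]^j, [0]^1, [λ]^j} with λ² = k:
HasSpectrumH : ∀ {n} → SignedGraph n → (k j : ℕ) → Set
HasSpectrumH H k j = ∀ x → charPoly (adj H) x ≡ ((x * x - + k) ^ j) * x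

DeletionYields : ∀ {n} → SignedGraph (suc n) → Fin (suc n) → SignedGraph n → Set
DeletionYields H v G = ∀ i j → adj H (punchIn v i) (punchIn v j) ≡ adj G i j

{-# OPTIONS --safe #-}

-- Let A be the adjacency matrix of G, κ = λ², and M = κI − A².  Since A is symmetric with
-- eigenvalues ±λ and ±1, (A² − κ)(A² − 1) = 0, so M is κ − 1 times the projection onto the
-- sum V of the eigenspaces for ±1; its diagonal entries are the deficits κ − deg.  Take a
-- vertex v with Mᵥᵥ = 1, let u = M eᵥ and w = A u.  Then u, w ∈ V, |u|² = |w|² = κ − 1,
-- and u·y = (κ − 1)yᵥ for y ∈ V.  The entry wᵥ = κAᵥᵥ − (A eᵥ)·A(A eᵥ) is even because A is
-- symmetric with zero diagonal, and |wᵥ| ≤ 1 by Cauchy–Schwarz; so wᵥ = 0 and u ⊥ w.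
--
-- Bordering A by u gives the matrix B of H, and a column operation yields its
-- characteristic polynomial x(x² − κ)^(j+1).  In particular ±1 are not eigenvalues of B,
-- which forces M = uuᵀ + wwᵀ: a vector of V orthogonal to u and w would produce such an
-- eigenvector.  Since the diagonal of M is at most 2, the entries of u and w are in
-- {0, 1, −1}, and vertex i of H has deficit wᵢ² ∈ {0, 1}.

module Submission where

open import Defs
open import Data.Nat using (ℕ; suc)
open import Data.Fin using (Fin)
open import Data.Product using (Σ; ∃; _×_)
open import Data.Sum using (_⊎_)
open import Relation.Binary.PropositionalEquality using (_≡_)

-- Finite sums, linear combinations and the dot product over the integers.

module Sums where

  open import Data.Nat using (zero; z≤n)
  open import Data.Fin using (zero; suc)
  open import Data.Integer using (ℤ; +_; _+_; _*_; _≤_; +≤+)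
  open import Data.Integer.Properties
  open import Data.Integer.Tactic.RingSolver using (solve-∀)
  open import Relation.Binary.PropositionalEquality using (_≗_; refl; sym; trans; cong; cong₂)

  Vec : ℕ → Set
  Vec n = Fin n → ℤ

  -- The common form of all linear combinations: sums, differences and multiples are instances of
  -- it, so one linearity lemma per operator suffices.
  lin : ∀ {n} → ℤ → Vec n → ℤ → Vec n → Vec n
  lin a u b v i = a * u i + b * v i

  Σ-cong : ∀ {n} {f g : Vec n} → f ≗ g → Σ-Fin n f ≡ Σ-Fin n g
  Σ-cong {zero}  f≗g = refl
  Σ-cong {suc n} f≗g = cong₂ _+_ (f≗g zero) (Σ-cong (λ i → f≗g (suc i)))

  Σ-lin : ∀ {n} a (u : Vec n) b v → Σ-Fin n (lin a u b v) ≡ a * Σ-Fin n u + b * Σ-Fin n v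
  Σ-lin {zero}  a u b v = sym (cong₂ _+_ (*-zeroʳ a) (*-zeroʳ b))
  Σ-lin {suc n} a u b v = trans (cong (_+_ (lin a u b v zero)) (Σ-lin a (λ i → u (suc i)) b (λ i → v (suc i))))
    (regroup a (u zero) (Σ-Fin n (λ i → u (suc i))) b (v zero) (Σ-Fin n (λ i → v (suc i))))
    where
    regroup : ∀ a p q b r s → (a * p + b * r) + (a * q + b * s) ≡ a * (p + q) + b * (r + s)
    regroup = solve-∀

  Σ-zero : ∀ {n} {f : Vec n} → (∀ i → f i ≡ + 0) → Σ-Fin n f ≡ + 0
  Σ-zero {zero}  f≡0 = refl
  Σ-zero {suc n} f≡0 = cong₂ _+_ (f≡0 zero) (Σ-zero (λ i → f≡0 (suc i)))

  Σ-*ˡ : ∀ {n} a (u : Vec n) → Σ-Fin n (λ i → a * u i) ≡ a * Σ-Fin n u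
  Σ-*ˡ {zero}  a u = sym (*-zeroʳ a)
  Σ-*ˡ {suc n} a u = trans (cong (_+_ (a * u zero)) (Σ-*ˡ a (λ i → u (suc i))))
    (sym (*-distribˡ-+ a (u zero) (Σ-Fin n (λ i → u (suc i)))))

  Σ-+ : ∀ {n} (u v : Vec n) → Σ-Fin n (λ i → u i + v i) ≡ Σ-Fin n u + Σ-Fin n v
  Σ-+ {zero}  u v = refl
  Σ-+ {suc n} u v = trans (cong (_+_ (u zero + v zero)) (Σ-+ (λ i → u (suc i)) (λ i → v (suc i))))
    (swap (u zero) (v zero) (Σ-Fin n (λ i → u (suc i))) (Σ-Fin n (λ i → v (suc i))))
    where
    swap : ∀ a b c d → (a + b) + (c + d) ≡ (a + c) + (b + d)
    swap = solve-∀

  Σ-swap : ∀ {m n} (f : Fin m → Fin n → ℤ) →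
           Σ-Fin m (λ i → Σ-Fin n (f i)) ≡ Σ-Fin n (λ j → Σ-Fin m (λ i → f i j))
  Σ-swap {zero}  {n} f = sym (Σ-zero {n} (λ _ → refl))
  Σ-swap {suc m} {n} f = trans (cong (_+_ (Σ-Fin n (f zero))) (Σ-swap (λ i → f (suc i))))
    (sym (Σ-+ (f zero) (λ j → Σ-Fin m (λ i → f (suc i) j))))

  -- Structural recursion lets the Kronecker delta reduce on constructors; `δ c` doubles as the
  -- standard basis vector at `c`.
  δ : ∀ {n} → Fin n → Vec n
  δ zero    zero    = + 1
  δ zero    (suc j) = + 0
  δ (suc i) zero    = + 0
  δ (suc i) (suc j) = δ i j

  δ-sym : ∀ {n} (i j : Fin n) → δ i j ≡ δ j i
  δ-sym zero    zero    = refl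
  δ-sym zero    (suc j) = refl
  δ-sym (suc i) zero    = refl
  δ-sym (suc i) (suc j) = δ-sym i j

  infix 8 _∙_
  _∙_ : ∀ {n} → Vec n → Vec n → ℤ
  u ∙ v = Σ-Fin _ (λ i → u i * v i)

  ∙-cong : ∀ {n} {u u′ v v′ : Vec n} → u ≗ u′ → v ≗ v′ → u ∙ v ≡ u′ ∙ v′
  ∙-cong p q = Σ-cong (λ i → cong₂ _*_ (p i) (q i))

  ∙-comm : ∀ {n} (u v : Vec n) → u ∙ v ≡ v ∙ u
  ∙-comm u v = Σ-cong (λ i → *-comm (u i) (v i))

  ∙-linʳ : ∀ {n} (x : Vec n) a u b v → x ∙ lin a u b v ≡ a * (x ∙ u) + b * (x ∙ v)
  ∙-linʳ x a u b v = trans (Σ-cong (λ i → regroup (x i) a (u i) b (v i)))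
                           (Σ-lin a (λ i → x i * u i) b (λ i → x i * v i))
    where
    regroup : ∀ x a u b v → x * (a * u + b * v) ≡ a * (x * u) + b * (x * v)
    regroup = solve-∀

  ∙-linˡ : ∀ {n} a u b v (x : Vec n) → lin a u b v ∙ x ≡ a * (u ∙ x) + b * (v ∙ x)
  ∙-linˡ a u b v x = trans (∙-comm _ x) (trans (∙-linʳ x a u b v)
    (cong₂ (λ p q → a * p + b * q) (∙-comm x u) (∙-comm x v)))

  δ-∙ : ∀ {n} (c : Fin n) v → δ c ∙ v ≡ v c
  δ-∙ zero    v = trans (cong₂ _+_ (*-identityˡ (v zero)) (Σ-zero (λ i → *-zeroˡ (v (suc i))))) (+-identityʳ (v zero))
  δ-∙ (suc c) v = trans (cong₂ _+_ (*-zeroˡ (v zero)) (δ-∙ c (λ i → v (suc i)))) (+-identityˡ _)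

  square-nonneg : ∀ a → + 0 ≤ a * a
  square-nonneg (+ n) = ≤-trans (+≤+ z≤n) (≤-reflexive (pos-* n n))
  square-nonneg (ℤ.negsuc n) = +≤+ z≤n

  ∙-nonneg : ∀ {n} (u : Vec n) → + 0 ≤ u ∙ u
  ∙-nonneg {zero}  u = +≤+ z≤n
  ∙-nonneg {suc n} u = +-mono-≤ (square-nonneg (u zero)) (∙-nonneg (λ i → u (suc i)))

  square-≤-∙ : ∀ {n} (u : Vec n) i → u i * u i ≤ u ∙ u
  square-≤-∙ u zero    = ≤-trans (≤-reflexive (sym (+-identityʳ _))) (+-monoʳ-≤ (u zero * u zero) (∙-nonneg (λ i → u (suc i))))
  square-≤-∙ u (suc i) = ≤-trans (square-≤-∙ (λ i → u (suc i)) i)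
    (≤-trans (≤-reflexive (sym (+-identityˡ _))) (+-monoˡ-≤ _ (square-nonneg (u zero))))

  ∙-definite : ∀ {n} (u : Vec n) → u ∙ u ≡ + 0 → ∀ i → u i ≡ + 0
  ∙-definite u u∙u≡0 i with i*j≡0⇒i≡0∨j≡0 (u i) (≤-antisym (≤-trans (square-≤-∙ u i) (≤-reflexive u∙u≡0)) (square-nonneg (u i)))
  ... | _⊎_.inj₁ p = p
  ... | _⊎_.inj₂ p = p

-- Determinants: multilinear and alternating in the columns.

module Determinant where

  open Sums
  open import Data.Nat using (zero; s≤s; z≤n)
  open import Data.Fin using (zero; suc; punchIn; punchOut; toℕ; _<_)
  open import Data.Fin.Properties using (_≟_; punchInᵢ≢i; punchIn-punchOut; punchIn-injective; <⇒≢; <-trans)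
  open import Data.Integer using (ℤ; +_; -_; _+_; _*_)
  open import Data.Integer.Properties hiding (_≟_; <-trans; <⇒≢)
  open import Data.Integer.Tactic.RingSolver using (solve-∀)
  open import Data.Vec.Functional using (updateAt)
  open import Data.Vec.Functional.Properties using (updateAt-updates; updateAt-minimal)
  open import Data.Product using (_,_)
  open import Data.Sum using (inj₁; inj₂)
  open import Data.Empty using (⊥-elim)
  open import Relation.Nullary using (yes; no)
  open import Relation.Binary.PropositionalEquality
    using (_≢_; refl; sym; trans; cong; cong₂; subst; ≢-sym; module ≡-Reasoning)
  open import Relation.Binary.Construct.Closure.Transitive using (TransClosure; [_]; _∷_)

  minor : ∀ {n} → Matrix (suc n) → Fin (suc n) → Matrix n
  minor M j a b = M (suc a) (punchIn j b)

  det-cong : ∀ n {M N : Matrix n} → (∀ i j → M i j ≡ N i j) → det n M ≡ det n N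
  det-cong zero    M≡N = refl
  det-cong (suc n) M≡N = Σ-cong (λ j → cong (sgn (toℕ j) *_)
    (cong₂ _*_ (M≡N zero j) (det-cong n (λ a b → M≡N (suc a) (punchIn j b)))))

  -- In the first-row expansion, the term at `c` splits in its entry and has equal minors; every
  -- other term keeps column `c` inside its minor, at position `punchOut j≢c`, and splits by
  -- induction. Comparing three matrices that agree off `c` makes the hypotheses pass directly to
  -- minors.
  det-linear : ∀ n {L M N : Matrix n} c a b →
    (∀ i → L i c ≡ a * M i c + b * N i c) →
    (∀ i d → d ≢ c → L i d ≡ M i d) → (∀ i d → d ≢ c → L i d ≡ N i d) →
    det n L ≡ a * det n M + b * det n N
  det-linear (suc n) {L} {M} {N} c a b Lc L≡M L≡N =
    trans (Σ-cong term) (Σ-lin a (λ j → sgn (toℕ j) * (M zero j * det n (minor M j)))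
                               b (λ j → sgn (toℕ j) * (N zero j * det n (minor N j))))
    where
    split-entry : ∀ s a m b k D → s * ((a * m + b * k) * D) ≡ a * (s * (m * D)) + b * (s * (k * D))
    split-entry = solve-∀
    split-minor : ∀ s m a D b E → s * (m * (a * D + b * E)) ≡ a * (s * (m * D)) + b * (s * (m * E))
    split-minor = solve-∀
    term : ∀ j → sgn (toℕ j) * (L zero j * det n (minor L j)) ≡
                 a * (sgn (toℕ j) * (M zero j * det n (minor M j))) +
                 b * (sgn (toℕ j) * (N zero j * det n (minor N j)))
    term j with j ≟ c
    ... | yes refl = trans (cong (λ t → sgn (toℕ j) * (t * det n (minor L j))) (Lc zero))
      (trans (split-entry (sgn (toℕ j)) a (M zero j) b (N zero j) (det n (minor L j)))
        (cong₂ (λ p q → a * (sgn (toℕ j) * (M zero j * p)) + b * (sgn (toℕ j) * (N zero j * q)))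
          (det-cong n (λ i d → L≡M (suc i) (punchIn j d) (punchInᵢ≢i j d)))
          (det-cong n (λ i d → L≡N (suc i) (punchIn j d) (punchInᵢ≢i j d)))))
    ... | no j≢c = trans (cong (λ t → sgn (toℕ j) * (L zero j * t)) (det-linear n c′ a b
          (λ i → subst (λ d → L (suc i) d ≡ a * M (suc i) d + b * N (suc i) d) (sym c′↦c) (Lc (suc i)))
          (λ i d d≢c′ → L≡M (suc i) (punchIn j d) (away d d≢c′))
          (λ i d d≢c′ → L≡N (suc i) (punchIn j d) (away d d≢c′))))
      (trans (split-minor (sgn (toℕ j)) (L zero j) a (det n (minor M j)) b (det n (minor N j)))
        (cong₂ (λ p q → a * (sgn (toℕ j) * (p * det n (minor M j))) + b * (sgn (toℕ j) * (q * det n (minor N j))))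
          (L≡M zero j j≢c) (L≡N zero j j≢c)))
      where
      c′ = punchOut j≢c
      c′↦c : punchIn j c′ ≡ c
      c′↦c = punchIn-punchOut j≢c
      away : ∀ d → d ≢ c′ → punchIn j d ≢ c
      away d d≢c′ eq = d≢c′ (punchIn-injective j d c′ (trans eq (sym c′↦c)))

  -- The covering relation of `Fin n`: the second index immediately follows the first. Only for
  -- adjacent columns do the two relevant minors coincide without a permutation.
  data _⋖_ : ∀ {n} → Fin n → Fin n → Set where
    ⋖-zero : ∀ {n} → zero {suc n} ⋖ suc zero
    ⋖-suc  : ∀ {n} {c d : Fin n} → c ⋖ d → suc c ⋖ suc d

  ⋖⇒< : ∀ {n} {c d : Fin n} → c ⋖ d → c < d
  ⋖⇒< ⋖-zero    = s≤s z≤n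
  ⋖⇒< (⋖-suc p) = s≤s (⋖⇒< p)

  ⋖-punchIn⁻ : ∀ {n} j (c d : Fin n) → punchIn j c ⋖ punchIn j d → c ⋖ d
  ⋖-punchIn⁻ zero          c       d             (⋖-suc p) = p
  ⋖-punchIn⁻ (suc zero)    zero    (suc d)       ()
  ⋖-punchIn⁻ (suc (suc j)) zero    (suc zero)    ⋖-zero    = ⋖-zero
  ⋖-punchIn⁻ (suc j)       (suc c) (suc d)       (⋖-suc p) = ⋖-suc (⋖-punchIn⁻ j c d p)

  -- Deleting either of two adjacent columns leaves the same list of columns, except at one position
  -- where each deletion shows the column removed by the other. If the two columns are equal, so are
  -- the two minors.
  punchIn-⋖ : ∀ {n} {c d : Fin (suc n)} → c ⋖ d → ∀ b →
              punchIn c b ≡ punchIn d b ⊎ (punchIn c b ≡ d × punchIn d b ≡ c)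
  punchIn-⋖ ⋖-zero    zero    = inj₂ (refl , refl)
  punchIn-⋖ ⋖-zero    (suc b) = inj₁ refl
  punchIn-⋖ (⋖-suc p) zero    = inj₁ refl
  punchIn-⋖ {suc n} (⋖-suc p) (suc b) with punchIn-⋖ p b
  ... | inj₁ eq        = inj₁ (cong suc eq)
  ... | inj₂ (eq , eq′) = inj₂ (cong suc eq , cong suc eq′)

  sgn-suc : ∀ m → sgn (suc m) ≡ - sgn m
  sgn-suc zero          = refl
  sgn-suc (suc zero)    = refl
  sgn-suc (suc (suc m)) = sgn-suc m

  sgn-⋖ : ∀ {n} {c d : Fin n} → c ⋖ d → sgn (toℕ d) ≡ - sgn (toℕ c)
  sgn-⋖ ⋖-zero    = refl
  sgn-⋖ {c = suc c} {suc d} (⋖-suc p) =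
    trans (sgn-suc (toℕ d)) (cong -_ (trans (sgn-⋖ p) (sym (sgn-suc (toℕ c)))))

  Σ-⋖-cancel : ∀ {n} {c d : Fin n} {f : Vec n} → c ⋖ d →
               (∀ j → j ≢ c → j ≢ d → f j ≡ + 0) → f c + f d ≡ + 0 → Σ-Fin n f ≡ + 0
  Σ-⋖-cancel {f = f} ⋖-zero f≡0 fc+fd =
    trans (sym (+-assoc (f zero) _ _))
      (cong₂ _+_ fc+fd (Σ-zero (λ i → f≡0 (suc (suc i)) (λ ()) (λ ()))))
  Σ-⋖-cancel (⋖-suc p) f≡0 fc+fd =
    cong₂ _+_ (f≡0 zero (λ ()) (λ ()))
      (Σ-⋖-cancel p (λ j j≢c j≢d → f≡0 (suc j) (λ { refl → j≢c refl }) (λ { refl → j≢d refl })) fc+fd)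

  -- A term of the expansion away from `c` and `d` has a minor that still contains two equal
  -- adjacent columns, so it vanishes by induction. The terms at `c` and `d` have equal minors and
  -- opposite signs.
  det-⋖-equal : ∀ n {M : Matrix n} {c d} → c ⋖ d → (∀ i → M i c ≡ M i d) → det n M ≡ + 0
  det-⋖-equal (suc n) {M} {c} {d} c⋖d Mc≡Md = Σ-⋖-cancel c⋖d vanish cancel
    where
    vanish : ∀ j → j ≢ c → j ≢ d → sgn (toℕ j) * (M zero j * det n (minor M j)) ≡ + 0
    vanish j j≢c j≢d = trans (cong (λ t → sgn (toℕ j) * (M zero j * t)) minor≡0)
      (trans (cong (sgn (toℕ j) *_) (*-zeroʳ (M zero j))) (*-zeroʳ (sgn (toℕ j))))
      where
      c↦ = punchIn-punchOut j≢c
      d↦ = punchIn-punchOut j≢d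
      minor≡0 : det n (minor M j) ≡ + 0
      minor≡0 = det-⋖-equal n {c = punchOut j≢c} {punchOut j≢d}
        (⋖-punchIn⁻ j _ _ (subst (_⋖ _) (sym c↦) (subst (_ ⋖_) (sym d↦) c⋖d)))
        (λ i → trans (cong (M (suc i)) c↦) (trans (Mc≡Md (suc i)) (cong (M (suc i)) (sym d↦))))
    same-minor : ∀ i b → minor M c i b ≡ minor M d i b
    same-minor i b with punchIn-⋖ c⋖d b
    ... | inj₁ eq         = cong (M (suc i)) eq
    ... | inj₂ (eq , eq′) = trans (cong (M (suc i)) eq) (trans (sym (Mc≡Md (suc i))) (cong (M (suc i)) (sym eq′)))
    opposite : ∀ s m D → s * (m * D) + (- s) * (m * D) ≡ + 0
    opposite = solve-∀
    cancel : sgn (toℕ c) * (M zero c * det n (minor M c)) + sgn (toℕ d) * (M zero d * det n (minor M d)) ≡ + 0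
    cancel = trans (cong (_+_ (sgn (toℕ c) * (M zero c * det n (minor M c))))
        (cong₂ _*_ (sgn-⋖ c⋖d) (cong₂ _*_ (sym (Mc≡Md zero)) (det-cong n (λ i b → sym (same-minor i b))))))
      (opposite (sgn (toℕ c)) (M zero c) (det n (minor M c)))

  setCol : ∀ {n} → Matrix n → Fin n → Vec n → Matrix n
  setCol M c v i = updateAt (M i) c (λ _ → v i)

  setCol-at : ∀ {n} (M : Matrix n) c v i → setCol M c v i c ≡ v i
  setCol-at M c v i = updateAt-updates c (M i)

  setCol-off : ∀ {n} (M : Matrix n) {c} v i d → d ≢ c → setCol M c v i d ≡ M i d
  setCol-off M {c} v i d d≢c = updateAt-minimal d c (M i) d≢c

  det-setCol-lin : ∀ {n} (M : Matrix n) c a u b v →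
    det n (setCol M c (lin a u b v)) ≡ a * det n (setCol M c u) + b * det n (setCol M c v)
  det-setCol-lin {n} M c a u b v = det-linear n c a b
    (λ i → trans (setCol-at M c (lin a u b v) i)
      (sym (cong₂ (λ p q → a * p + b * q) (setCol-at M c u i) (setCol-at M c v i))))
    (λ i d d≢c → trans (setCol-off M (lin a u b v) i d d≢c) (sym (setCol-off M u i d d≢c)))
    (λ i d d≢c → trans (setCol-off M (lin a u b v) i d d≢c) (sym (setCol-off M v i d d≢c)))

  det-setCol-cong : ∀ {n} (M : Matrix n) c {u v} → (∀ i → u i ≡ v i) →
                    det n (setCol M c u) ≡ det n (setCol M c v)
  det-setCol-cong {n} M c {u} {v} u≡v = det-cong n entry
    where
    entry : ∀ i d → setCol M c u i d ≡ setCol M c v i d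
    entry i d = cong (λ t → updateAt (M i) c (λ _ → t) d) (u≡v i)

  setCol-id : ∀ {n} (M : Matrix n) c {v} → (∀ i → v i ≡ M i c) → ∀ i d → setCol M c v i d ≡ M i d
  setCol-id M c {v} v≡Mc i d with d ≟ c
  ... | yes refl = trans (setCol-at M c v i) (v≡Mc i)
  ... | no d≢c   = setCol-off M v i d d≢c

  det-setCol-Σ : ∀ {m n} (M : Matrix n) c (y : Vec m) (V : Fin m → Vec n) →
    det n (setCol M c (λ i → Σ-Fin m (λ d → y d * V d i))) ≡ Σ-Fin m (λ d → y d * det n (setCol M c (V d)))
  det-setCol-Σ {zero}  M c y V = det-setCol-lin M c (+ 0) (λ _ → + 0) (+ 0) (λ _ → + 0)
  det-setCol-Σ {suc m} {n} M c y V =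
    trans (det-setCol-cong M c (λ i → cong (_+_ (y zero * V zero i)) (sym (*-identityˡ (Σ-Fin m (λ d → y (suc d) * V (suc d) i))))))
      (trans (det-setCol-lin M c (y zero) (V zero) (+ 1) rest)
        (cong (_+_ (y zero * det n (setCol M c (V zero)))) (trans (*-identityˡ (det n (setCol M c rest)))
          (det-setCol-Σ M c (λ d → y (suc d)) (λ d → V (suc d))))))
    where
    rest : Vec n
    rest i = Σ-Fin m (λ d → y (suc d) * V (suc d) i)

  _⋖⁺_ : ∀ {n} → Fin n → Fin n → Set
  _⋖⁺_ = TransClosure _⋖_

  ⋖⁺⇒< : ∀ {n} {c d : Fin n} → c ⋖⁺ d → c < d
  ⋖⁺⇒< [ p ]    = ⋖⇒< p
  ⋖⁺⇒< (p ∷ ps) = <-trans (⋖⇒< p) (⋖⁺⇒< ps)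

  ⋖⁺-suc : ∀ {n} {c d : Fin n} → c ⋖⁺ d → suc c ⋖⁺ suc d
  ⋖⁺-suc [ p ]    = [ ⋖-suc p ]
  ⋖⁺-suc (p ∷ ps) = ⋖-suc p ∷ ⋖⁺-suc ps

  zero-⋖⁺-suc : ∀ {n} (d : Fin n) → zero ⋖⁺ suc d
  zero-⋖⁺-suc zero    = [ ⋖-zero ]
  zero-⋖⁺-suc (suc d) = ⋖-zero ∷ ⋖⁺-suc (zero-⋖⁺-suc d)

  ⋖⁺-connex : ∀ {n} (c d : Fin n) → c ≢ d → c ⋖⁺ d ⊎ d ⋖⁺ c
  ⋖⁺-connex zero    zero    c≢d = ⊥-elim (c≢d refl)
  ⋖⁺-connex zero    (suc d) c≢d = inj₁ (zero-⋖⁺-suc d)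
  ⋖⁺-connex (suc c) zero    c≢d = inj₂ (zero-⋖⁺-suc c)
  ⋖⁺-connex (suc c) (suc d) c≢d with ⋖⁺-connex c d (λ eq → c≢d (cong suc eq))
  ... | inj₁ p = inj₁ (⋖⁺-suc p)
  ... | inj₂ p = inj₂ (⋖⁺-suc p)

  -- Polarising det-⋖-equal at u + v shows that exchanging the adjacent columns c and e
  -- changes the sign; the exchanged matrix has equal columns e and d, which are closer.
  det-⋖⁺-equal : ∀ {n} {M : Matrix n} {c d} → c ⋖⁺ d → (∀ i → M i c ≡ M i d) → det n M ≡ + 0
  det-⋖⁺-equal [ c⋖d ] Mc≡Md = det-⋖-equal _ c⋖d Mc≡Md
  det-⋖⁺-equal {n} {M} {c} {d} (_∷_ {y = e} c⋖e e⋖⁺d) Mc≡Md = begin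
    det n M                         ≡⟨ det-cong n unchanged ⟨
    P v u                           ≡⟨ +-identityˡ _ ⟨
    + 0 + P v u                     ≡⟨ cong (_+ P v u) swapped ⟨
    P u v + P v u                   ≡⟨ polarised ⟩
    + 0                             ∎
    where
    open ≡-Reasoning
    u v : Vec n
    u i = M i e
    v i = M i c
    c≢e = <⇒≢ (⋖⇒< c⋖e)
    d≢e = ≢-sym (<⇒≢ (⋖⁺⇒< e⋖⁺d))
    d≢c = ≢-sym (<⇒≢ (⋖⁺⇒< (c⋖e ∷ e⋖⁺d)))
    two : Vec n → Vec n → Matrix n
    two a b = setCol (setCol M c a) e b
    P : Vec n → Vec n → ℤ
    P a b = det n (two a b)
    two-e : ∀ a b i → two a b i e ≡ b i
    two-e a b i = setCol-at (setCol M c a) e b i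
    two-c : ∀ a b i → two a b i c ≡ a i
    two-c a b i = trans (setCol-off (setCol M c a) b i c c≢e) (setCol-at M c a i)
    two-d : ∀ a b i → two a b i d ≡ M i d
    two-d a b i = trans (setCol-off (setCol M c a) b i d d≢e) (setCol-off M a i d d≢c)
    unchanged : ∀ i j → two v u i j ≡ M i j
    unchanged i j = trans (setCol-id (setCol M c v) e
        (λ i → sym (setCol-off M v i e (≢-sym c≢e))) i j) (setCol-id M c (λ _ → refl) i j)
    swapped : P u v ≡ + 0
    swapped = det-⋖⁺-equal e⋖⁺d (λ i → trans (two-e u v i) (trans (Mc≡Md i) (sym (two-d u v i))))
    diagonal : ∀ a → P a a ≡ + 0
    diagonal a = det-⋖-equal n c⋖e (λ i → trans (two-c a a i) (sym (two-e a a i)))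
    s : Vec n
    s = lin (+ 1) u (+ 1) v
    left : ∀ b → P s b ≡ + 1 * P u b + + 1 * P v b
    left b = det-linear n c (+ 1) (+ 1)
      (λ i → trans (two-c s b i) (sym (cong₂ (λ p q → + 1 * p + + 1 * q) (two-c u b i) (two-c v b i))))
      (agree u) (agree v)
      where
      agree : ∀ a i j → j ≢ c → two s b i j ≡ two a b i j
      agree a i j j≢c with j ≟ e
      ... | yes refl = trans (two-e s b i) (sym (two-e a b i))
      ... | no j≢e   = trans (setCol-off (setCol M c s) b i j j≢e) (trans (setCol-off M s i j j≢c)
                         (sym (trans (setCol-off (setCol M c a) b i j j≢e) (setCol-off M a i j j≢c))))
    expand : ∀ a b c d → + 1 * (+ 1 * a + + 1 * c) + + 1 * (+ 1 * b + + 1 * d) ≡ (a + d) + (c + b)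
    expand = solve-∀
    bilinear : P s s ≡ (P u u + P v v) + (P v u + P u v)
    bilinear = trans (det-setCol-lin (setCol M c s) e (+ 1) u (+ 1) v)
      (trans (cong₂ (λ p q → + 1 * p + + 1 * q) (left u) (left v)) (expand (P u u) (P u v) (P v u) (P v v)))
    polarised : P u v + P v u ≡ + 0
    polarised = begin
      P u v + P v u                           ≡⟨ +-comm (P u v) (P v u) ⟩
      P v u + P u v                           ≡⟨ +-identityˡ _ ⟨
      (+ 0 + + 0) + (P v u + P u v)           ≡⟨ cong (_+ (P v u + P u v)) (cong₂ _+_ (diagonal u) (diagonal v)) ⟨
      (P u u + P v v) + (P v u + P u v)       ≡⟨ bilinear ⟨
      P s s                                   ≡⟨ diagonal s ⟩
      + 0                                     ∎

  det-alternating : ∀ {n} {M : Matrix n} {c d} → c ≢ d → (∀ i → M i c ≡ M i d) → det n M ≡ + 0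
  det-alternating {c = c} {d} c≢d Mc≡Md with ⋖⁺-connex c d c≢d
  ... | inj₁ p = det-⋖⁺-equal p Mc≡Md
  ... | inj₂ p = det-⋖⁺-equal p (λ i → sym (Mc≡Md i))

  δ-≡ : ∀ {n} (c : Fin n) → δ c c ≡ + 1
  δ-≡ zero    = refl
  δ-≡ (suc c) = δ-≡ c

  δ-≢ : ∀ {n} {c d : Fin n} → c ≢ d → δ c d ≡ + 0
  δ-≢ {c = zero}  {zero}  c≢d = ⊥-elim (c≢d refl)
  δ-≢ {c = zero}  {suc d} c≢d = refl
  δ-≢ {c = suc c} {zero}  c≢d = refl
  δ-≢ {c = suc c} {suc d} c≢d = δ-≢ (λ eq → c≢d (cong suc eq))

  det-setCol-self : ∀ {n} (M : Matrix n) c d → det n (setCol M c (λ i → M i d)) ≡ δ c d * det n M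
  det-setCol-self {n} M c d with c ≟ d
  ... | yes refl = trans (det-cong n (setCol-id M c (λ _ → refl)))
                     (sym (trans (cong (_* det n M) (δ-≡ c)) (*-identityˡ _)))
  ... | no c≢d   = trans (det-alternating c≢d (λ i → trans (setCol-at M c Md i) (sym (setCol-off M Md i d (≢-sym c≢d)))))
                     (sym (cong (_* det n M) (δ-≢ c≢d)))
    where
    Md : Vec n
    Md i = M i d

  -- Cramer's rule and the adjugate.

  infixr 8 _⊛_
  _⊛_ : ∀ {n} → Matrix n → Vec n → Vec n
  (M ⊛ y) i = M i ∙ y

  -- `M ⊛ y` is the combination of the columns of `M` with coefficients `y`; after multilinear
  -- expansion every summand except the one at `c` repeats a column. Stated as a product, the rule
  -- needs no division.
  cramer : ∀ {n} (M : Matrix n) c y → det n (setCol M c (M ⊛ y)) ≡ y c * det n M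
  cramer {n} M c y = begin
    det n (setCol M c (M ⊛ y))
      ≡⟨ det-setCol-cong M c (λ i → ∙-comm (M i) y) ⟩
    det n (setCol M c (λ i → Σ-Fin n (λ d → y d * M i d)))
      ≡⟨ det-setCol-Σ M c y (λ d i → M i d) ⟩
    Σ-Fin n (λ d → y d * det n (setCol M c (λ i → M i d)))
      ≡⟨ Σ-cong (λ d → trans (cong (y d *_) (det-setCol-self M c d)) (regroup (y d) (δ c d) (det n M))) ⟩
    Σ-Fin n (λ d → det n M * (δ c d * y d))
      ≡⟨ Σ-*ˡ (det n M) (λ d → δ c d * y d) ⟩
    det n M * (δ c ∙ y)
      ≡⟨ cong (det n M *_) (δ-∙ c y) ⟩
    det n M * y c
      ≡⟨ *-comm (det n M) (y c) ⟩
    y c * det n M ∎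
    where
    open ≡-Reasoning
    regroup : ∀ y e D → y * (e * D) ≡ D * (e * y)
    regroup = solve-∀

  -- Row `c` of the adjugate, each cofactor being obtained by putting a basis vector in column `c`.
  adjugateRow : ∀ {n} → Matrix n → Fin n → Vec n
  adjugateRow {n} M c i = det n (setCol M c (δ i))

  -- The identity adj(M) M = det(M) I, entry by entry: the sum over `i` reassembles column `d` in
  -- position `c`.
  adjugateRow-∙ : ∀ {n} (M : Matrix n) c d → adjugateRow M c ∙ (λ i → M i d) ≡ δ c d * det n M
  adjugateRow-∙ {n} M c d = trans (∙-comm (adjugateRow M c) (λ i → M i d))
    (trans (sym (det-setCol-Σ M c (λ i → M i d) δ))
      (trans (det-setCol-cong M c (λ i → trans (∙-comm (λ j → M j d) (λ j → δ j i))
                (trans (∙-cong {v = λ j → M j d} (λ j → δ-sym j i) (λ _ → refl)) (δ-∙ i (λ j → M j d)))))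
             (det-setCol-self M c d)))

  det-zero-column : ∀ {n} {M : Matrix n} c → (∀ i → M i c ≡ + 0) → det n M ≡ + 0
  det-zero-column {n} c Mc≡0 =
    det-linear n c (+ 0) (+ 0) Mc≡0 (λ _ _ _ → refl) (λ _ _ _ → refl)

  -- The expansion runs along the first row, and every minor other than the first retains column
  -- zero, whose lower entries vanish.
  det-first-column : ∀ {n} {M : Matrix (suc n)} → (∀ i → M (suc i) zero ≡ + 0) →
                     det (suc n) M ≡ M zero zero * det n (λ a b → M (suc a) (suc b))
  det-first-column {n} {M} M≡0 = trans (cong₂ _+_ (*-identityˡ top) (Σ-zero rest)) (+-identityʳ top)
    where
    top = M zero zero * det n (λ a b → M (suc a) (suc b))
    rest : ∀ j → sgn (suc (toℕ j)) * (M zero (suc j) * det n (minor M (suc j))) ≡ + 0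
    rest j = trans (cong (λ t → sgn (suc (toℕ j)) * (M zero (suc j) * t)) (singular n M j M≡0))
      (trans (cong (sgn (suc (toℕ j)) *_) (*-zeroʳ (M zero (suc j)))) (*-zeroʳ (sgn (suc (toℕ j)))))
      where
      singular : ∀ n (M : Matrix (suc n)) j → (∀ i → M (suc i) zero ≡ + 0) → det n (minor M (suc j)) ≡ + 0
      singular (suc n) M j M≡0 = det-zero-column {M = minor M (suc j)} zero M≡0

  -- By Cramer's rule `y c * det n M` is the determinant of a matrix with a zero column, and the
  -- integers have no zero divisors.
  kernel-trivial : ∀ {n} (M : Matrix n) {y} → det n M ≢ + 0 → (∀ i → (M ⊛ y) i ≡ + 0) → ∀ c → y c ≡ + 0
  kernel-trivial {n} M {y} det≢0 My≡0 c with i*j≡0⇒i≡0∨j≡0 (y c)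
    (trans (sym (cramer M c y)) (det-zero-column {M = setCol M c (M ⊛ y)} c (λ i → trans (setCol-at M c (M ⊛ y) i) (My≡0 i))))
  ... | inj₁ p = p
  ... | inj₂ p = ⊥-elim (det≢0 p)

-- The sum-of-absolute-values norm on integer vectors.

module Norm where

  open Sums
  open import Data.Nat using (zero; _+_; _*_; _≤_; z≤n)
  open import Data.Nat.Properties
  open import Data.Nat.Tactic.RingSolver using (solve-∀)
  open import Data.Fin using (zero; suc)
  open import Data.Integer using (∣_∣)
  open import Data.Integer.Properties using (∣i+j∣≤∣i∣+∣j∣)

  ‖_‖ : ∀ {n} → Vec n → ℕ
  ‖_‖ {zero}  f = 0
  ‖_‖ {suc n} f = ∣ f zero ∣ + ‖ (λ i → f (suc i)) ‖

  ∣Σ∣≤‖‖ : ∀ {n} (f : Vec n) → ∣ Σ-Fin n f ∣ ≤ ‖ f ‖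
  ∣Σ∣≤‖‖ {zero}  f = z≤n
  ∣Σ∣≤‖‖ {suc n} f = ≤-trans (∣i+j∣≤∣i∣+∣j∣ (f zero) (Σ-Fin n (λ i → f (suc i))))
                             (+-monoʳ-≤ ∣ f zero ∣ (∣Σ∣≤‖‖ (λ i → f (suc i))))

  ∣∣≤‖‖ : ∀ {n} (f : Vec n) i → ∣ f i ∣ ≤ ‖ f ‖
  ∣∣≤‖‖ f zero    = m≤m+n _ _
  ∣∣≤‖‖ f (suc i) = ≤-trans (∣∣≤‖‖ (λ i → f (suc i)) i) (m≤n+m _ _)

  ‖‖-mono : ∀ {n} {f g : Vec n} → (∀ i → ∣ f i ∣ ≤ ∣ g i ∣) → ‖ f ‖ ≤ ‖ g ‖
  ‖‖-mono {zero}  f≤g = z≤n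
  ‖‖-mono {suc n} f≤g = +-mono-≤ (f≤g zero) (‖‖-mono (λ i → f≤g (suc i)))

  ‖‖-bound : ∀ {n} (f g : Vec n) a b → (∀ i → a * ∣ f i ∣ ≤ ∣ g i ∣ + b) → a * ‖ f ‖ ≤ ‖ g ‖ + n * b
  ‖‖-bound {zero}  f g a b f≤g = ≤-reflexive (*-zeroʳ a)
  ‖‖-bound {suc n} f g a b f≤g = begin
    a * (∣ f zero ∣ + ‖ f′ ‖)                   ≡⟨ *-distribˡ-+ a ∣ f zero ∣ ‖ f′ ‖ ⟩
    a * ∣ f zero ∣ + a * ‖ f′ ‖                 ≤⟨ +-mono-≤ (f≤g zero) (‖‖-bound f′ g′ a b (λ i → f≤g (suc i))) ⟩
    (∣ g zero ∣ + b) + (‖ g′ ‖ + n * b)         ≡⟨ regroup ∣ g zero ∣ b ‖ g′ ‖ (n * b) ⟩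
    (∣ g zero ∣ + ‖ g′ ‖) + (b + n * b)         ∎
    where
    open ≤-Reasoning
    f′ g′ : Vec n
    f′ i = f (suc i)
    g′ i = g (suc i)
    regroup : ∀ p q r s → (p + q) + (r + s) ≡ (p + r) + (q + s)
    regroup = solve-∀

-- The matrix xI - A, the Cayley-Hamilton argument and the minimal polynomial.

module Resolvent {n : ℕ} (A : Matrix n) where

  open Sums
  open Determinant
  open Norm
  import Data.Nat as ℕ
  import Data.Nat.Properties as ℕ
  open import Data.Integer using (ℤ; +_; -_; _+_; _*_; _-_; _^_; ∣_∣)
  open import Data.Integer.Properties
  open import Data.Integer.Tactic.RingSolver using (solve-∀)
  open import Data.Product using (_,_; proj₁; proj₂)
  open import Data.Empty using (⊥-elim)
  open import Relation.Binary.PropositionalEquality using (_≗_; refl; sym; trans; cong; cong₂; module ≡-Reasoning)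

  T : Vec n → Vec n
  T v = A ⊛ v

  T-cong : ∀ {u v} → u ≗ v → T u ≗ T v
  T-cong u≗v i = ∙-cong {u = A i} (λ _ → refl) u≗v

  T-lin : ∀ a u b v → T (lin a u b v) ≗ lin a (T u) b (T v)
  T-lin a u b v i = ∙-linʳ (A i) a u b v

  T-δ : ∀ c i → T (δ c) i ≡ A i c
  T-δ c i = trans (∙-comm (A i) (δ c)) (δ-∙ c (A i))

  -- The matrix xI - A itself, not its inverse.
  resolvent : ℤ → Matrix n
  resolvent x i j = x * δ i j - A i j

  resolvent-⊛ : ∀ x d i → (resolvent x ⊛ d) i ≡ x * d i - T d i
  resolvent-⊛ x d i = begin
    resolvent x i ∙ d                           ≡⟨ ∙-cong {u = resolvent x i} {v = d} (λ j → as-lin x (δ i j) (A i j)) (λ _ → refl) ⟩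
    lin x (δ i) (- + 1) (A i) ∙ d               ≡⟨ ∙-linˡ x (δ i) (- + 1) (A i) d ⟩
    x * (δ i ∙ d) + (- + 1) * (A i ∙ d)         ≡⟨ cong (λ t → x * t + (- + 1) * (A i ∙ d)) (δ-∙ i d) ⟩
    x * d i + (- + 1) * (A i ∙ d)               ≡⟨ as-sub x (d i) (A i ∙ d) ⟩
    x * d i - T d i                             ∎
    where
    open ≡-Reasoning
    as-lin : ∀ x e a → x * e - a ≡ x * e + (- + 1) * a
    as-lin = solve-∀
    as-sub : ∀ x d t → x * d + (- + 1) * t ≡ x * d - t
    as-sub = solve-∀

  -- An integer vector z lying in (x - A)ℤⁿ for every x vanishes: for x large compared
  -- with z, a nonzero preimage would be too long.
  in-all-ranges⇒0 : (∀ i j → ∣ A i j ∣ ℕ.≤ 1) → ∀ z →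
    (∀ x → ∃ λ d → ∀ i → z i ≡ x * d i - T d i) → ∀ i → z i ≡ + 0
  in-all-ranges⇒0 ∣A∣≤1 z range i = trans (z≡ i) (trans (cong₂ (λ p q → x * p - q) (d≡0 i) Td≡0) (vanish x))
    where
    -- Summing `entry` over all `i` gives X‖d‖ ≤ ‖z‖ + n‖d‖. The summand `n` of `X` absorbs the
    -- contribution of `T d`, leaving (1 + ‖z‖)‖d‖ ≤ ‖z‖, which forces d = 0.
    X = ℕ.suc ‖ z ‖ ℕ.+ n
    x = + X
    d = proj₁ (range x)
    z≡ = proj₂ (range x)
    ∣Td∣≤ : ∀ i → ∣ T d i ∣ ℕ.≤ ‖ d ‖
    ∣Td∣≤ i = ℕ.≤-trans (∣Σ∣≤‖‖ (λ j → A i j * d j)) (‖‖-mono (λ j →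
      ℕ.≤-trans (ℕ.≤-reflexive (abs-* (A i j) (d j)))
        (ℕ.≤-trans (ℕ.*-monoˡ-≤ ∣ d j ∣ (∣A∣≤1 i j)) (ℕ.≤-reflexive (ℕ.*-identityˡ ∣ d j ∣)))))
    move : ∀ z x d t → z ≡ x * d - t → x * d ≡ z + t
    move z x d t eq = trans (split x d t) (cong (_+ t) (sym eq))
      where
      split : ∀ x d t → x * d ≡ (x * d - t) + t
      split = solve-∀
    entry : ∀ i → X ℕ.* ∣ d i ∣ ℕ.≤ ∣ z i ∣ ℕ.+ ‖ d ‖
    entry i = begin
      X ℕ.* ∣ d i ∣             ≡⟨ abs-* x (d i) ⟨
      ∣ x * d i ∣               ≡⟨ cong ∣_∣ (move (z i) x (d i) (T d i) (z≡ i)) ⟩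
      ∣ z i + T d i ∣           ≤⟨ ∣i+j∣≤∣i∣+∣j∣ (z i) (T d i) ⟩
      ∣ z i ∣ ℕ.+ ∣ T d i ∣     ≤⟨ ℕ.+-monoʳ-≤ ∣ z i ∣ (∣Td∣≤ i) ⟩
      ∣ z i ∣ ℕ.+ ‖ d ‖         ∎
      where open ℕ.≤-Reasoning
    short : ℕ.suc ‖ z ‖ ℕ.* ‖ d ‖ ℕ.≤ ‖ z ‖
    short = ℕ.+-cancelʳ-≤ (n ℕ.* ‖ d ‖) _ _
      (ℕ.≤-trans (ℕ.≤-reflexive (sym (ℕ.*-distribʳ-+ ‖ d ‖ (ℕ.suc ‖ z ‖) n))) (‖‖-bound d z X ‖ d ‖ entry))
    only-zero : ∀ a b → ℕ.suc a ℕ.* b ℕ.≤ a → b ≡ 0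
    only-zero a ℕ.zero    _ = refl
    only-zero a (ℕ.suc b) p = ⊥-elim (ℕ.<-irrefl refl (ℕ.≤-trans (ℕ.m≤m*n (ℕ.suc a) (ℕ.suc b)) p))
    d≡0 : ∀ i → d i ≡ + 0
    d≡0 i = ∣i∣≡0⇒i≡0 (ℕ.n≤0⇒n≡0 (ℕ.≤-trans (∣∣≤‖‖ d i) (ℕ.≤-reflexive (only-zero ‖ z ‖ ‖ d ‖ short))))
    Td≡0 : T d i ≡ + 0
    Td≡0 = Σ-zero (λ j → trans (cong (A i j *_) (d≡0 j)) (*-zeroʳ (A i j)))
    vanish : ∀ x → x * + 0 - + 0 ≡ + 0
    vanish x = trans (+-identityʳ (x * + 0)) (*-zeroʳ x)

  -- The operator A² - κ; its instance at 1 is the other factor of the minimal polynomial.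
  A²- : ℤ → Vec n → Vec n
  A²- κ y = lin (+ 1) (T (T y)) (- κ) y

  A²-^ : ℤ → ℕ → Vec n → Vec n
  A²-^ κ ℕ.zero    y = y
  A²-^ κ (ℕ.suc j) y = A²-^ κ j (A²- κ y)

  A²-cong : ∀ κ {u v} → u ≗ v → A²- κ u ≗ A²- κ v
  A²-cong κ u≗v i = cong₂ (λ p q → + 1 * p + - κ * q) (T-cong (T-cong u≗v) i) (u≗v i)

  -- From A² - κ = (x² - κ) - (x - A)(x + A): the witness is -(x + A)y. Modulo the range of x - A,
  -- the matrix A acts as the scalar x.
  A²-mod-range : ∀ κ x y → ∃ λ d → ∀ i → A²- κ y i ≡ (x * x - κ) * y i + (x * d i - T d i)
  A²-mod-range κ x y = lin (- + 1) (T y) (- x) y , λ i →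
    trans (expand (T (T y) i) (T y i) (y i) κ x)
      (cong (λ t → (x * x - κ) * y i + (x * lin (- + 1) (T y) (- x) y i - t))
            (sym (T-lin (- + 1) (T y) (- x) y i)))
    where
    expand : ∀ ttv tv v κ x → + 1 * ttv + - κ * v ≡
      (x * x - κ) * v + (x * ((- + 1) * tv + - x * v) - ((- + 1) * ttv + - x * tv))
    expand = solve-∀

  A²-^-mod-range : ∀ κ x j y → ∃ λ d → ∀ i →
    A²-^ κ j y i ≡ (x * x - κ) ^ j * y i + (x * d i - T d i)
  A²-^-mod-range κ x ℕ.zero y = (λ _ → + 0) , λ i →
    sym (trans (cong₂ _+_ (*-identityˡ (y i)) (cong₂ _-_ (*-zeroʳ x) (Σ-zero (λ j → *-zeroʳ (A i j)))))
               (+-identityʳ (y i)))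
  A²-^-mod-range κ x (ℕ.suc j) y with A²-^-mod-range κ x j (A²- κ y) | A²-mod-range κ x y
  ... | d , eq | d′ , eq′ = lin q d′ (+ 1) d , λ i →
    trans (eq i) (trans (cong (λ t → q * t + (x * d i - T d i)) (eq′ i))
      (trans (expand q (x * x - κ) (y i) x (d′ i) (T d′ i) (d i) (T d i))
        (cong (λ t → (x * x - κ) * q * y i + (x * lin q d′ (+ 1) d i - t)) (sym (T-lin q d′ (+ 1) d i)))))
    where
    q = (x * x - κ) ^ j
    expand : ∀ q r y x d′ t′ d t → q * (r * y + (x * d′ - t′)) + (x * d - t) ≡
      r * q * y + (x * (q * d′ + + 1 * d) - (q * t′ + + 1 * t))
    expand = solve-∀

  module Symmetric (A-sym : ∀ i j → A i j ≡ A j i) where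

    T-adjoint : ∀ u v → T u ∙ v ≡ u ∙ T v
    T-adjoint u v = begin
      Σ-Fin n (λ i → T u i * v i)
        ≡⟨ Σ-cong (λ i → trans (*-comm (T u i) (v i)) (sym (Σ-*ˡ (v i) (λ j → A i j * u j)))) ⟩
      Σ-Fin n (λ i → Σ-Fin n (λ j → v i * (A i j * u j)))
        ≡⟨ Σ-swap (λ i j → v i * (A i j * u j)) ⟩
      Σ-Fin n (λ j → Σ-Fin n (λ i → v i * (A i j * u j)))
        ≡⟨ Σ-cong (λ j → trans (Σ-cong (λ i → trans (cong (λ a → v i * (a * u j)) (A-sym i j))
                                                    (regroup (v i) (A j i) (u j))))
                               (Σ-*ˡ (u j) (λ i → A j i * v i))) ⟩
      u ∙ T v ∎
      where
      open ≡-Reasoning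
      regroup : ∀ v a u → v * (a * u) ≡ u * (a * v)
      regroup = solve-∀

    A²-adjoint : ∀ κ u v → A²- κ u ∙ v ≡ u ∙ A²- κ v
    A²-adjoint κ u v = trans (∙-linˡ (+ 1) (T (T u)) (- κ) u v)
      (trans (cong (λ t → + 1 * t + - κ * (u ∙ v)) (trans (T-adjoint (T u) v) (T-adjoint u (T v))))
             (sym (∙-linʳ u (+ 1) (T (T v)) (- κ) v)))

    -- Write N = A² - κ, which is self-adjoint. If N²y = 0 then |Ny|² = y · N²y = 0; applying this
    -- repeatedly lowers any power of N to the first.
    A²-nilpotent : ∀ κ j y → (∀ i → A²-^ κ j y i ≡ + 0) → ∀ i → A²- κ y i ≡ + 0
    A²-nilpotent κ ℕ.zero y y≡0 i = trans (A²-cong κ y≡0 i)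
      (cong₂ (λ p q → + 1 * p + q) (Σ-zero (λ j → trans (cong (A i j *_) (Σ-zero (λ l → *-zeroʳ (A j l)))) (*-zeroʳ (A i j))))
             (*-zeroʳ (- κ)))
    A²-nilpotent κ (ℕ.suc ℕ.zero) y p = p
    A²-nilpotent κ (ℕ.suc (ℕ.suc j)) y p = ∙-definite (A²- κ y)
      (trans (A²-adjoint κ y (A²- κ y))
        (Σ-zero (λ i → trans (cong (y i *_) (A²-nilpotent κ (ℕ.suc j) (A²- κ y) p i)) (*-zeroʳ (y i)))))

    -- Since x - A is symmetric, the row identity for the adjugate also reads (x - A)b = det(x - A)
    -- e_c, so this multiple of the basis vector lies in the range of x - A.
    resolvent-adjugateRow : ∀ x c i →
      δ c i * det n (resolvent x) ≡ x * adjugateRow (resolvent x) c i - T (adjugateRow (resolvent x) c) i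
    resolvent-adjugateRow x c i = trans (sym (adjugateRow-∙ (resolvent x) c i))
      (trans (∙-comm b (λ j → resolvent x j i))
        (trans (∙-cong {v = b} (λ j → cong₂ (λ p q → x * p - q) (δ-sym j i) (A-sym j i)) (λ _ → refl))
          (resolvent-⊛ x b i)))
      where b = adjugateRow (resolvent x) c

    -- Cayley–Hamilton followed by the semisimplicity of symmetric matrices.
    minimal-polynomial : (∀ i j → ∣ A i j ∣ ℕ.≤ 1) → ∀ κ j →
      (∀ x → det n (resolvent x) ≡ (x * x - κ) ^ j * (x * x - + 1)) →
      ∀ c i → A²- κ (A²- (+ 1) (δ c)) i ≡ + 0
    minimal-polynomial ∣A∣≤1 κ j charpoly c = A²-nilpotent κ j y (in-all-ranges⇒0 ∣A∣≤1 (A²-^ κ j y) range)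
      where
      y = A²- (+ 1) (δ c)
      expand : ∀ q r e x d₂ t₂ d₁ t₁ b t → e * (q * r) ≡ x * b - t →
        q * (r * e + (x * d₂ - t₂)) + (x * d₁ - t₁) ≡
        x * (+ 1 * (+ 1 * b + q * d₂) + + 1 * d₁) - (+ 1 * (+ 1 * t + q * t₂) + + 1 * t₁)
      expand q r e x d₂ t₂ d₁ t₁ b t eq =
        trans (before q r e x d₂ t₂ d₁ t₁) (trans (cong (λ s → s + q * (x * d₂ - t₂) + (x * d₁ - t₁)) eq)
          (after q x d₂ t₂ d₁ t₁ b t))
        where
        before : ∀ q r e x d₂ t₂ d₁ t₁ → q * (r * e + (x * d₂ - t₂)) + (x * d₁ - t₁) ≡
          e * (q * r) + q * (x * d₂ - t₂) + (x * d₁ - t₁)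
        before = solve-∀
        after : ∀ q x d₂ t₂ d₁ t₁ b t → (x * b - t) + q * (x * d₂ - t₂) + (x * d₁ - t₁) ≡
          x * (+ 1 * (+ 1 * b + q * d₂) + + 1 * d₁) - (+ 1 * (+ 1 * t + q * t₂) + + 1 * t₁)
        after = solve-∀
      -- Modulo the range of x - A, the vector (A² - κ)^j (A² - 1) e_c equals (x² - κ)^j (x² - 1)
      -- e_c. That is det(x - A) e_c, which is in the range by the adjugate identity.
      range : ∀ x → ∃ λ d → ∀ i → A²-^ κ j y i ≡ x * d i - T d i
      range x with A²-^-mod-range κ x j y | A²-mod-range (+ 1) x (δ c)
      ... | d₁ , eq₁ | d₂ , eq₂ = lin (+ 1) (lin (+ 1) b q d₂) (+ 1) d₁ , λ i →
        trans (eq₁ i) (trans (cong (λ t → q * t + (x * d₁ i - T d₁ i)) (eq₂ i))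
          (trans (expand q (x * x - + 1) (δ c i) x (d₂ i) (T d₂ i) (d₁ i) (T d₁ i) (b i) (T b i)
                    (trans (cong (δ c i *_) (sym (charpoly x))) (resolvent-adjugateRow x c i)))
            (cong (λ t → x * lin (+ 1) (lin (+ 1) b q d₂) (+ 1) d₁ i - t)
              (sym (trans (T-lin (+ 1) (lin (+ 1) b q d₂) (+ 1) d₁ i)
                (cong (λ t → + 1 * t + + 1 * T d₁ i) (T-lin (+ 1) b q d₂ i)))))))
        where
        q = (x * x - κ) ^ j
        b = adjugateRow (resolvent x) c

-- The characteristic polynomial as a determinant, and congruences modulo an integer.

module CharPoly where

  open Sums
  open Determinant
  open import Data.Nat using (zero)
  open import Data.Fin using (zero; suc; punchIn; toℕ)
  open import Data.Fin.Properties using (_≟_)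
  open import Data.Integer using (ℤ; +_; _+_; _*_; _-_; _^_)
  open import Data.Integer.Properties using (+-inverseʳ; *-identityʳ; *-zeroʳ)
  open import Data.Integer.Divisibility.Signed using (_∣_; divides; ∣m∣n⇒∣m+n; ∣n⇒∣m*n)
  open import Data.Integer.Tactic.RingSolver using (solve-∀)
  open import Relation.Nullary using (yes; no)
  open import Relation.Binary.PropositionalEquality using (refl; sym; trans; cong; subst)

  -- The local function δ of charPoly has no name outside Defs; unification recovers the
  -- matrix built from it.
  mutual
    characteristicMatrix : ∀ {n} → Matrix n → ℤ → Matrix n
    characteristicMatrix A x = _

    charPoly-det : ∀ {n} (A : Matrix n) x → charPoly A x ≡ det n (characteristicMatrix A x)
    charPoly-det A x = refl

  characteristicMatrix-resolvent : ∀ {n} (A : Matrix n) x i j →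
    characteristicMatrix A x i j ≡ Resolvent.resolvent A x i j
  characteristicMatrix-resolvent A x i j with i ≟ j
  ... | yes refl = cong (_- A i i) (sym (trans (cong (x *_) (δ-≡ i)) (*-identityʳ x)))
  ... | no i≢j   = cong (_- A i j) (sym (trans (cong (x *_) (δ-≢ i≢j)) (*-zeroʳ x)))

  charPoly-resolvent : ∀ {n} (A : Matrix n) x → charPoly A x ≡ det n (Resolvent.resolvent A x)
  charPoly-resolvent {n} A x = trans (charPoly-det A x) (det-cong n (characteristicMatrix-resolvent A x))

  module Congruence (N : ℤ) where

    infix 4 _≈_
    -- As a record, the relation determines its two sides during unification, which a bare
    -- divisibility of `a - b` would not.
    record _≈_ (a b : ℤ) : Set where
      constructor congruent
      field ∣difference : N ∣ a - b

    open _≈_ public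

    ≈-reflexive : ∀ {a b} → a ≡ b → a ≈ b
    ≈-reflexive {a} refl = congruent (subst (N ∣_) (sym (+-inverseʳ a)) (divides (+ 0) refl))

    ≈-+ : ∀ {a b c d} → a ≈ b → c ≈ d → a + c ≈ b + d
    ≈-+ {a} {b} {c} {d} (congruent p) (congruent q) =
      congruent (subst (N ∣_) (regroup a b c d) (∣m∣n⇒∣m+n p q))
      where
      regroup : ∀ a b c d → (a - b) + (c - d) ≡ (a + c) - (b + d)
      regroup = solve-∀

    ≈-* : ∀ {a b c d} → a ≈ b → c ≈ d → a * c ≈ b * d
    ≈-* {a} {b} {c} {d} (congruent p) (congruent q) =
      congruent (subst (N ∣_) (regroup a b c d) (∣m∣n⇒∣m+n (∣n⇒∣m*n c p) (∣n⇒∣m*n b q)))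
      where
      regroup : ∀ a b c d → c * (a - b) + b * (c - d) ≡ a * c - b * d
      regroup = solve-∀

    ≈-^ : ∀ {a b} m → a ≈ b → a ^ m ≈ b ^ m
    ≈-^ zero    p = ≈-reflexive refl
    ≈-^ (suc m) p = ≈-* p (≈-^ m p)

    ≈-Σ : ∀ {n} {f g : Vec n} → (∀ i → f i ≈ g i) → Σ-Fin n f ≈ Σ-Fin n g
    ≈-Σ {zero}  p = ≈-reflexive refl
    ≈-Σ {suc n} p = ≈-+ (p zero) (≈-Σ (λ i → p (suc i)))

    -- A determinant is an integer polynomial in its entries. This congruence replaces an identity
    -- theorem for polynomials when a factor cannot be cancelled pointwise.
    ≈-det : ∀ n {L M : Matrix n} → (∀ i j → L i j ≈ M i j) → det n L ≈ det n M
    ≈-det zero    p = ≈-reflexive refl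
    ≈-det (suc n) p = ≈-Σ (λ j → ≈-* (≈-reflexive {sgn (toℕ j)} refl)
      (≈-* (p zero j) (≈-det n (λ a b → p (suc a) (punchIn j b)))))

-- Entries in {0, 1, -1}, degrees as sums of squares, and parity of quadratic forms.

module Combinatorial where

  open Sums
  open import Data.Nat using (zero; s≤s; z≤n)
  import Data.Nat as ℕ
  open import Data.Fin using (zero; suc)
  open import Data.Integer using (ℤ; +_; -[1+_]; _+_; _*_; _≤_; +≤+; ∣_∣)
  open import Data.Nat.Properties using (even≢odd; m+1+n≢0; n≤0⇒n≡0)
  open import Data.Integer.Properties using (_≟_; +-identityˡ; +-identityʳ; ≤-trans; ≤-reflexive; +-monoʳ-≤; +-injective; abs-*)
  open import Data.Integer.Tactic.RingSolver using (solve-∀)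
  open import Data.List using (length; filter; tabulate)
  open import Data.Product using (_,_)
  open import Data.Sum using (inj₁; inj₂)
  open import Data.Empty using (⊥-elim)
  open import Relation.Nullary using (¬?; yes; no)
  open import Relation.Binary.PropositionalEquality using (refl; sym; trans; cong; cong₂; module ≡-Reasoning)

  Sign₀ : ℤ → Set
  Sign₀ a = a ≡ + 0 ⊎ a ≡ + 1 ⊎ a ≡ -[1+ 0 ]

  square≤2⇒Sign₀ : ∀ a → a * a ≤ + 2 → Sign₀ a
  square≤2⇒Sign₀ (+ 0)            _ = inj₁ refl
  square≤2⇒Sign₀ (+ 1)            _ = inj₂ (inj₁ refl)
  square≤2⇒Sign₀ (+ suc (suc n))  (+≤+ (s≤s (s≤s p))) = ⊥-elim (m+1+n≢0 n (n≤0⇒n≡0 p))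
  square≤2⇒Sign₀ -[1+ 0 ]         _ = inj₂ (inj₂ refl)
  square≤2⇒Sign₀ -[1+ suc n ]     (+≤+ (s≤s (s≤s p))) = ⊥-elim (m+1+n≢0 n (n≤0⇒n≡0 p))

  summandˡ-Sign₀ : ∀ a b → a * a + b * b ≤ + 2 → Sign₀ a
  summandˡ-Sign₀ a b p = square≤2⇒Sign₀ a
    (≤-trans (≤-reflexive (sym (+-identityʳ (a * a)))) (≤-trans (+-monoʳ-≤ (a * a) (square-nonneg b)) p))

  Sign₀-deficit : ∀ d k {a} → Sign₀ a → + d + a * a ≡ + k → d ≡ k ⊎ d ℕ.+ 1 ≡ k
  Sign₀-deficit d k (inj₁ refl)        eq = inj₁ (+-injective (trans (sym (+-identityʳ (+ d))) eq))
  Sign₀-deficit d k (inj₂ (inj₁ refl)) eq = inj₂ (+-injective eq)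
  Sign₀-deficit d k (inj₂ (inj₂ refl)) eq = inj₂ (+-injective eq)

  even-square≤1⇒0 : ∀ s → (∃ λ r → s ≡ r + r) → s * s ≤ + 1 → s ≡ + 0
  even-square≤1⇒0 s (r , s≡2r) s²≤1 with square≤2⇒Sign₀ s (≤-trans s²≤1 (+≤+ (s≤s z≤n)))
  ... | inj₁ p        = p
  ... | inj₂ (inj₁ p) = ⊥-elim (even≢odd ∣ r ∣ 0 (trans (sym ∣s∣≡2∣r∣) (cong ∣_∣ p)))
    where
    double : ∀ r → r + r ≡ + 2 * r
    double = solve-∀
    ∣s∣≡2∣r∣ = trans (cong ∣_∣ (trans s≡2r (double r))) (abs-* (+ 2) r)
  ... | inj₂ (inj₂ p) = ⊥-elim (even≢odd ∣ r ∣ 0 (trans (sym ∣s∣≡2∣r∣) (cong ∣_∣ p)))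
    where
    double : ∀ r → r + r ≡ + 2 * r
    double = solve-∀
    ∣s∣≡2∣r∣ = trans (cong ∣_∣ (trans s≡2r (double r))) (abs-* (+ 2) r)

  -- A nonzero entry is ±1 and has square 1. The map `h` is general because `allFin` is a tabulation
  -- whose tail tabulates a shifted function.
  count-nonzero : ∀ {m n} (f : Vec n) → (∀ i → Sign₀ (f i)) → (h : Fin m → Fin n) →
    + length (filter (λ j → ¬? (f j ≟ + 0)) (tabulate h)) ≡ (λ i → f (h i)) ∙ (λ i → f (h i))
  count-nonzero {zero}  f f± h = refl
  count-nonzero {suc m} {n} f f± h with f (h zero) ≟ + 0 | f± (h zero)
  ... | yes p | _              = trans (count-nonzero f f± (λ i → h (suc i)))
                                  (trans (sym (+-identityˡ (rest ∙ rest))) (cong (_+ rest ∙ rest) (sym (cong₂ _*_ p p))))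
    where
    rest : Vec m
    rest i = f (h (suc i))
  ... | no ¬p | inj₁ p         = ⊥-elim (¬p p)
  ... | no ¬p | inj₂ (inj₁ p)  = cong₂ _+_ (sym (cong₂ _*_ p p)) (count-nonzero f f± (λ i → h (suc i)))
  ... | no ¬p | inj₂ (inj₂ p)  = cong₂ _+_ (sym (cong₂ _*_ p p)) (count-nonzero f f± (λ i → h (suc i)))

  degree-∙ : ∀ {n} (G : SignedGraph n) i → + degree G i ≡ adj G i ∙ adj G i
  degree-∙ G i = count-nonzero (adj G i) (entries G i) (λ j → j)

  open Determinant using (_⊛_)

  -- The diagonal terms vanish and the off-diagonal ones occur in equal pairs. Splitting off the
  -- first row and column yields the same sum twice.
  quadratic-form-even : ∀ {n} (S : Matrix n) → (∀ i j → S i j ≡ S j i) → (∀ i → S i i ≡ + 0) →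
    ∀ x → ∃ λ r → x ∙ (S ⊛ x) ≡ r + r
  quadratic-form-even {zero}  S S-sym S-diag x = + 0 , refl
  quadratic-form-even {suc n} S S-sym S-diag x
    with quadratic-form-even (λ i j → S (suc i) (suc j)) (λ i j → S-sym (suc i) (suc j))
                             (λ i → S-diag (suc i)) (λ i → x (suc i))
  ... | r , eq = x zero * (S₀ ∙ x′) + r , (begin
    x zero * (S zero zero * x zero + S₀ ∙ x′) + x′ ∙ (λ i → S (suc i) zero * x zero + (S′ ⊛ x′) i)
      ≡⟨ cong₂ (λ a b → x zero * (a * x zero + S₀ ∙ x′) + b) (S-diag zero)
           (trans (Σ-cong (λ i → trans (cong (λ a → x′ i * (a * x zero + (S′ ⊛ x′) i)) (S-sym (suc i) zero))
                                       (regroup (x′ i) (S₀ i) (x zero) ((S′ ⊛ x′) i))))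
                  (Σ-lin (x zero) (λ i → S₀ i * x′ i) (+ 1) (λ i → x′ i * (S′ ⊛ x′) i))) ⟩
    x zero * (+ 0 * x zero + S₀ ∙ x′) + (x zero * (S₀ ∙ x′) + + 1 * (x′ ∙ (S′ ⊛ x′)))
      ≡⟨ cong (λ t → x zero * (+ 0 * x zero + S₀ ∙ x′) + (x zero * (S₀ ∙ x′) + + 1 * t)) eq ⟩
    x zero * (+ 0 * x zero + S₀ ∙ x′) + (x zero * (S₀ ∙ x′) + + 1 * (r + r))
      ≡⟨ collect (x zero) (S₀ ∙ x′) r ⟩
    (x zero * (S₀ ∙ x′) + r) + (x zero * (S₀ ∙ x′) + r) ∎)
    where
    open ≡-Reasoning
    x′ S₀ : Vec n
    x′ i = x (suc i)
    S₀ i = S zero (suc i)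
    S′ : Matrix n
    S′ i j = S (suc i) (suc j)
    regroup : ∀ y a z t → y * (a * z + t) ≡ z * (a * y) + + 1 * (y * t)
    regroup = solve-∀
    collect : ∀ z a r → z * (+ 0 * z + a) + (z * a + + 1 * (r + r)) ≡ (z * a + r) + (z * a + r)
    collect = solve-∀

-- The matrix κI - A² and the space V fixed by A².

module Extension {n : ℕ} (G : SignedGraph n) (k j : ℕ) (spectrum : HasSpectrumG G k j) where

  open Sums
  open Determinant
  open CharPoly
  open Combinatorial
  import Data.Nat as ℕ
  import Data.Nat.Properties as ℕ
  import Data.Nat.Divisibility as ℕ
  open import Data.Fin using (zero; suc)
  open import Data.Integer using (ℤ; +_; -_; _+_; _*_; _-_; _^_; _≤_; +≤+; +<+; ∣_∣; NonZero; >-nonZero; ≢-nonZero; Positive; positive)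
  open import Data.Integer.Properties
  open import Data.Integer.Divisibility.Signed using (_∣_; divides; ∣⇒∣ᵤ; ∣m∣n⇒∣m+n)
  open import Data.Integer.Tactic.RingSolver using (solve-∀)
  open import Data.Product using (_,_; proj₁; proj₂)
  open import Data.Sum using (inj₁; inj₂)
  open import Data.Empty using (⊥-elim)
  open import Relation.Binary.PropositionalEquality
    using (_≗_; _≢_; refl; sym; trans; cong; cong₂; subst; module ≡-Reasoning)

  A = adj G
  κ = + k

  open Resolvent A
  open Symmetric (symm G)

  -- Membership in V, the sum of the eigenspaces for ±1, expressed without splitting a vector into
  -- its two components.
  Fixed : Vec n → Set
  Fixed y = T (T y) ≗ y

  Fixed-T : ∀ {y} → Fixed y → Fixed (T y)
  Fixed-T fix = T-cong fix

  TT-lin : ∀ a u b v → T (T (lin a u b v)) ≗ lin a (T (T u)) b (T (T v))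
  TT-lin a u b v i = trans (T-cong (T-lin a u b v) i) (T-lin a (T u) b (T v) i)

  Fixed-lin : ∀ {u v} a b → Fixed u → Fixed v → Fixed (lin a u b v)
  Fixed-lin {u} {v} a b fu fv i = trans (TT-lin a u b v i) (cong₂ (λ p q → a * p + b * q) (fu i) (fv i))

  -- Column `c` of M = κI - A².
  col : Fin n → Vec n
  col c = lin κ (δ c) (- + 1) (T (T (δ c)))

  ∣A∣≤1 : ∀ i j → ∣ A i j ∣ ℕ.≤ 1
  ∣A∣≤1 i j with entries G i j
  ... | inj₁ p        = subst (λ a → ∣ a ∣ ℕ.≤ 1) (sym p) ℕ.z≤n
  ... | inj₂ (inj₁ p) = subst (λ a → ∣ a ∣ ℕ.≤ 1) (sym p) ℕ.≤-refl
  ... | inj₂ (inj₂ p) = subst (λ a → ∣ a ∣ ℕ.≤ 1) (sym p) ℕ.≤-refl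

  charpoly : ∀ x → det n (resolvent x) ≡ (x * x - κ) ^ j * (x * x - + 1)
  charpoly x = trans (sym (charPoly-resolvent A x)) (spectrum x)

  -- The relation (A² - κ)(A² - 1)e_c = 0, rearranged as A²(κ - A²)e_c = (κ - A²)e_c.
  col-fixed : ∀ c → Fixed (col c)
  col-fixed c i = trans (TT-lin κ (δ c) (- + 1) (T (T (δ c))) i)
    (solve-for (T (T (T (T (δ c)))) i) (T (T (δ c)) i) (δ c i)
      (trans (cong (λ t → + 1 * t + - κ * A²- (+ 1) (δ c) i) (sym (TT-lin (+ 1) (T (T (δ c))) (- + 1) (δ c) i)))
             (minimal-polynomial ∣A∣≤1 κ j charpoly c i)))
    where
    solve-for : ∀ f₄ f₂ f₀ → + 1 * (+ 1 * f₄ + - + 1 * f₂) + - κ * (+ 1 * f₂ + - + 1 * f₀) ≡ + 0 →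
      κ * f₂ + - + 1 * f₄ ≡ κ * f₀ + - + 1 * f₂
    solve-for f₄ f₂ f₀ eq = trans (before κ f₄ f₂ f₀) (trans (cong (λ t → κ * f₀ + - + 1 * f₂ - t) eq) (+-identityʳ _))
      where
      before : ∀ κ f₄ f₂ f₀ → κ * f₂ + - + 1 * f₄ ≡
        κ * f₀ + - + 1 * f₂ - (+ 1 * (+ 1 * f₄ + - + 1 * f₂) + - κ * (+ 1 * f₂ + - + 1 * f₀))
      before = solve-∀

  -- Self-adjointness moves both factors of A onto `y`, where A² acts as the identity; thus M acts
  -- on V as κ - 1.
  col-∙ : ∀ c {y} → Fixed y → col c ∙ y ≡ (κ - + 1) * y c
  col-∙ c {y} fix = begin
    col c ∙ y                                         ≡⟨ ∙-linˡ κ (δ c) (- + 1) (T (T (δ c))) y ⟩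
    κ * (δ c ∙ y) + - + 1 * (T (T (δ c)) ∙ y)         ≡⟨ cong₂ (λ p q → κ * p + - + 1 * q) (δ-∙ c y) move ⟩
    κ * y c + - + 1 * y c                             ≡⟨ *-distribʳ-+ (y c) κ (- + 1) ⟨
    (κ - + 1) * y c                                   ∎
    where
    open ≡-Reasoning
    move : T (T (δ c)) ∙ y ≡ y c
    move = trans (T-adjoint (T (δ c)) y) (trans (T-adjoint (δ c) (T y)) (trans (δ-∙ c (T (T y))) (fix c)))

  -- The diagonal entry of A² at `c` is the sum of the squares of row `c`, which is the degree.
  col-diagonal : ∀ c d → degree G c ℕ.+ d ≡ k → col c c ≡ + d
  col-diagonal c d deg+d≡k = begin
    κ * δ c c + - + 1 * T (T (δ c)) c            ≡⟨ cong₂ (λ p q → κ * p + - + 1 * q) (δ-≡ c) square ⟩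
    κ * + 1 + - + 1 * + degree G c               ≡⟨ cong (λ t → t * + 1 + - + 1 * + degree G c)
                                                      (trans (cong +_ (sym deg+d≡k)) (pos-+ (degree G c) d)) ⟩
    (+ degree G c + + d) * + 1 + - + 1 * + degree G c  ≡⟨ cancel (+ degree G c) (+ d) ⟩
    + d                                          ∎
    where
    open ≡-Reasoning
    square : T (T (δ c)) c ≡ + degree G c
    square = trans (∙-cong {u = A c} (λ _ → refl) (λ i → trans (T-δ c i) (symm G i c))) (sym (degree-∙ G c))
    cancel : ∀ a d → (a + d) * + 1 + - + 1 * a ≡ d
    cancel = solve-∀

  -- The column u at a vertex of deficit one, and its image w = Au.

  module _ (v : Fin n) (deg-v : degree G v ℕ.+ 1 ≡ k) where

    u w : Vec n
    u = col v
    w = T u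

    u-fixed : Fixed u
    u-fixed = col-fixed v

    w-fixed : Fixed w
    w-fixed = Fixed-T {u} u-fixed

    uᵥ≡1 : u v ≡ + 1
    uᵥ≡1 = col-diagonal v 1 deg-v

    u∙u : u ∙ u ≡ κ - + 1
    u∙u = trans (col-∙ v u-fixed) (trans (cong ((κ - + 1) *_) uᵥ≡1) (*-identityʳ (κ - + 1)))

    w∙w : w ∙ w ≡ κ - + 1
    w∙w = trans (T-adjoint u w) (trans (∙-cong {u = u} (λ _ → refl) u-fixed) u∙u)

    -- The single entry 1 of `u` at `v` already bounds |u|² = κ - 1 from below; all later
    -- cancellations of κ - 1 rest on this.
    1≤κ-1 : + 1 ≤ κ - + 1
    1≤κ-1 = ≤-trans (≤-reflexive (sym (cong₂ _*_ uᵥ≡1 uᵥ≡1))) (≤-trans (square-≤-∙ u v) (≤-reflexive u∙u))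

    instance
      κ-1-positive : Positive (κ - + 1)
      κ-1-positive = positive (<-≤-trans (+<+ (ℕ.s≤s ℕ.z≤n)) 1≤κ-1)

      κ-1-nonZero : NonZero (κ - + 1)
      κ-1-nonZero = >-nonZero (<-≤-trans (+<+ (ℕ.s≤s ℕ.z≤n)) 1≤κ-1)

    wᵥ-even : ∃ λ r → w v ≡ r + r
    wᵥ-even = - r , (begin
      w v                                             ≡⟨ δ-∙ v (T u) ⟨
      δ v ∙ T u                                       ≡⟨ T-adjoint (δ v) u ⟨
      T (δ v) ∙ u                                     ≡⟨ ∙-linʳ (T (δ v)) κ (δ v) (- + 1) (T (T (δ v))) ⟩
      κ * (T (δ v) ∙ δ v) + - + 1 * (T (δ v) ∙ T (T (δ v)))
        ≡⟨ cong₂ (λ p q → κ * p + - + 1 * q)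
             (trans (∙-comm (T (δ v)) (δ v)) (trans (δ-∙ v (T (δ v))) (trans (T-δ v v) (loopless G v)))) (proj₂ form) ⟩
      κ * + 0 + - + 1 * (r + r)                       ≡⟨ collect κ r ⟩
      - r + - r                                       ∎)
      where
      open ≡-Reasoning
      form = quadratic-form-even A (symm G) (loopless G) (T (δ v))
      r = proj₁ form
      collect : ∀ κ r → κ * + 0 + - + 1 * (r + r) ≡ - r + - r
      collect = solve-∀

    -- Cauchy–Schwarz, as 0 ≤ |w − wᵥ u|².
    wᵥ²≤1 : w v * w v ≤ + 1
    wᵥ²≤1 = 0≤i-j⇒j≤i (*-cancelˡ-≤-pos (+ 0) (+ 1 - s * s) (κ - + 1)
      (≤-trans (≤-reflexive (*-zeroʳ (κ - + 1))) (≤-trans (∙-nonneg d) (≤-reflexive norm))))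
      where
      open ≡-Reasoning
      s = w v
      d = lin (+ 1) w (- s) u
      d∙ : ∀ x → d ∙ x ≡ + 1 * (w ∙ x) + - s * (u ∙ x)
      d∙ = ∙-linˡ (+ 1) w (- s) u
      collect : ∀ c s → + 1 * (+ 1 * c + - s * (c * s)) + - s * (+ 1 * (c * s) + - s * c) ≡ c * (+ 1 - s * s)
      collect = solve-∀
      norm : d ∙ d ≡ (κ - + 1) * (+ 1 - s * s)
      norm = trans (∙-linʳ d (+ 1) w (- s) u) (trans (cong₂ (λ p q → + 1 * p + - s * q) (d∙ w) (d∙ u))
        (trans (cong₂ (λ p q → + 1 * (+ 1 * p + - s * (u ∙ w)) + - s * (+ 1 * (w ∙ u) + - s * q)) w∙w u∙u)
          (trans (cong₂ (λ p q → + 1 * (+ 1 * (κ - + 1) + - s * p) + - s * (+ 1 * q + - s * (κ - + 1)))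
                        (col-∙ v w-fixed) (trans (∙-comm w u) (col-∙ v w-fixed)))
                 (collect (κ - + 1) s))))

    wᵥ≡0 : w v ≡ + 0
    wᵥ≡0 = even-square≤1⇒0 (w v) wᵥ-even wᵥ²≤1

    -- The bordered matrix and its characteristic polynomial.

    B : Matrix (suc n)
    B zero    zero    = + 0
    B zero    (suc j) = u j
    B (suc i) zero    = u i
    B (suc i) (suc j) = A i j

    module B = Resolvent B

    target : ℤ → ℤ
    target x = (x * x - κ) ^ suc j * x

    -- Replacing column zero of xI − B by its product with (x² − 1, xu + w), which is
    -- (x(x² − κ), 0, …, 0).
    bordered-det-multiple : ∀ x → (x * x - + 1) * det (suc n) (B.resolvent x) ≡ (x * x - + 1) * target x
    bordered-det-multiple x = begin
      (x * x - + 1) * det (suc n) K          ≡⟨ cramer K zero y ⟨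
      det (suc n) (setCol K zero (K ⊛ y))    ≡⟨ det-first-column {M = setCol K zero (K ⊛ y)} lower ⟩
      (K ⊛ y) zero * det n (resolvent x)     ≡⟨ cong₂ _*_ top (charpoly x) ⟩
      x * (x * x - κ) * ((x * x - κ) ^ j * (x * x - + 1))
                                             ≡⟨ regroup x (x * x - κ) ((x * x - κ) ^ j) (x * x - + 1) ⟩
      (x * x - + 1) * target x               ∎
      where
      open ≡-Reasoning
      K = B.resolvent x
      -- The lower block is (x + A)u. Because A² fixes `u`, (x - A)(x + A)u = (x² - 1)u, which
      -- cancels the border column times x² - 1.
      y : Vec (suc n)
      y zero    = x * x - + 1
      y (suc i) = lin x u (+ 1) w i
      regroup : ∀ x a b c → x * a * (b * c) ≡ c * (a * b * x)
      regroup = solve-∀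
      top-identity : ∀ x κ → x * (x * x - + 1) - (+ 0 * (x * x - + 1) + (x * (κ - + 1) + + 1 * ((κ - + 1) * + 0))) ≡ x * (x * x - κ)
      top-identity = solve-∀
      top : (K ⊛ y) zero ≡ x * (x * x - κ)
      top = trans (B.resolvent-⊛ x y zero)
        (trans (cong (λ t → x * (x * x - + 1) - (+ 0 * (x * x - + 1) + t))
                 (trans (∙-linʳ u x u (+ 1) w)
                   (cong₂ (λ p q → x * p + + 1 * q) u∙u (trans (col-∙ v w-fixed) (cong ((κ - + 1) *_) wᵥ≡0)))))
               (top-identity x κ))
      lower-identity : ∀ x u w → x * (x * u + + 1 * w) - (u * (x * x - + 1) + (x * w + + 1 * u)) ≡ + 0
      lower-identity = solve-∀
      lower : ∀ i → (K ⊛ y) (suc i) ≡ + 0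
      lower i = trans (B.resolvent-⊛ x y (suc i))
        (trans (cong (λ t → x * lin x u (+ 1) w i - (u i * (x * x - + 1) + t))
                 (trans (T-lin x u (+ 1) w i) (cong (λ t → x * w i + + 1 * t) (u-fixed i))))
               (lower-identity x (u i) (w i)))

    -- At x = ±1 the factor x² − 1 cannot be cancelled.  Both sides are polynomial in x,
    -- so their difference at x is divisible by every N for which x + N is harmless.
    bordered-det : ∀ x → det (suc n) (B.resolvent x) ≡ target x
    bordered-det x = i-j≡0⇒i≡j _ _ (∣i∣≡0⇒i≡0 (small (∣ D ∣) refl))
      where
      D = det (suc n) (B.resolvent x) - target x
      -- Since N > 1 + |x|, the shifted point x + N is not ±1; since N > |D|, divisibility of `D` by
      -- N forces D = 0.
      N = 3 ℕ.+ ∣ x ∣ ℕ.+ ∣ D ∣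
      x′ = x + + N
      open Congruence (+ N)
      x≈x′ : x ≈ x′
      x≈x′ = congruent (divides (- + 1) (shift x (+ N)))
        where
        shift : ∀ x N → x - (x + N) ≡ - + 1 * N
        shift = solve-∀
      harmless : x′ * x′ - + 1 ≢ + 0
      harmless eq = ℕ.<⇒≱ (ℕ.s≤s (ℕ.≤-trans (ℕ.n≤1+n _) (ℕ.m≤m+n (2 ℕ.+ ∣ x ∣) ∣ D ∣))) N≤
        where
        ∣x′∣≡1 : ∣ x′ ∣ ≡ 1
        ∣x′∣≡1 = ℕ.m*n≡1⇒m≡1 ∣ x′ ∣ ∣ x′ ∣ (trans (sym (abs-* x′ x′)) (cong ∣_∣ (i-j≡0⇒i≡j (x′ * x′) (+ 1) eq)))
        back : ∀ x N → N ≡ (x + N) - x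
        back = solve-∀
        N≤ : N ℕ.≤ 1 ℕ.+ ∣ x ∣
        N≤ = ℕ.≤-trans (ℕ.≤-reflexive (cong ∣_∣ (back x (+ N))))
          (ℕ.≤-trans (∣i-j∣≤∣i∣+∣j∣ x′ x) (ℕ.≤-reflexive (cong (ℕ._+ ∣ x ∣) ∣x′∣≡1)))
      at-x′ : det (suc n) (B.resolvent x′) ≡ target x′
      at-x′ = *-cancelˡ-≡ (x′ * x′ - + 1) _ _ {{≢-nonZero harmless}} (bordered-det-multiple x′)
      det≈ : det (suc n) (B.resolvent x) ≈ det (suc n) (B.resolvent x′)
      det≈ = ≈-det (suc n) (λ i j → ≈-+ (≈-* x≈x′ (≈-reflexive {δ i j} refl)) (≈-reflexive {a = - B i j} refl))
      target≈ : target x′ ≈ target x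
      target≈ = ≈-* (≈-^ (suc j) (≈-+ (≈-* x′≈x x′≈x) (≈-reflexive {a = - κ} refl))) x′≈x
        where
        x′≈x : x′ ≈ x
        x′≈x = congruent (divides (+ 1) (shift x (+ N)))
          where
          shift : ∀ x N → (x + N) - x ≡ + 1 * N
          shift = solve-∀
      N∣D : N ℕ.∣ ∣ D ∣
      N∣D = ∣⇒∣ᵤ (subst (+ N ∣_) telescope (∣m∣n⇒∣m+n (∣difference det≈) (∣difference target≈)))
        where
        collapse : ∀ a b c → (a - b) + (b - c) ≡ a - c
        collapse = solve-∀
        telescope : (det (suc n) (B.resolvent x) - det (suc n) (B.resolvent x′)) + (target x′ - target x) ≡ D
        telescope = trans (cong (λ t → (det (suc n) (B.resolvent x) - t) + (target x′ - target x)) at-x′)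
          (collapse (det (suc n) (B.resolvent x)) (target x′) (target x))
      small : ∀ m → ∣ D ∣ ≡ m → m ≡ 0
      small ℕ.zero    _  = refl
      small (ℕ.suc m) eq = ⊥-elim (ℕ.<⇒≱ (ℕ.m<n+m ∣ D ∣ {3 ℕ.+ ∣ x ∣} (ℕ.s≤s ℕ.z≤n))
        (ℕ.∣⇒≤ {{ℕ.≢-nonZero (λ z → ℕ.1+n≢0 (trans (sym eq) z))}} N∣D))

    -- The value at ε = ±1 is (1 - κ)^(j+1) ε, and κ - 1 is at least 1.
    bordered-det≢0 : ∀ ε → ε * ε ≡ + 1 → det (suc n) (B.resolvent ε) ≢ + 0
    bordered-det≢0 ε ε² eq with i*j≡0⇒i≡0∨j≡0 ((ε * ε - κ) ^ suc j) (trans (sym (bordered-det ε)) eq)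
    ... | inj₂ ε≡0 = 1≢0 (trans (sym ε²) (cong₂ _*_ ε≡0 ε≡0))
      where
      1≢0 : + 1 ≢ + 0
      1≢0 ()
    ... | inj₁ pow = power≢0 (suc j) pow
      where
      flip : ∀ κ → κ - + 1 ≡ - (+ 1 - κ)
      flip = solve-∀
      base≢0 : ε * ε - κ ≢ + 0
      base≢0 p = <-irrefl refl (<-≤-trans (+<+ (ℕ.s≤s ℕ.z≤n))
        (≤-trans 1≤κ-1 (≤-reflexive (trans (flip κ) (cong -_ (trans (cong (_- κ) (sym ε²)) p))))))
      power≢0 : ∀ m → (ε * ε - κ) ^ m ≢ + 0
      power≢0 ℕ.zero    ()
      power≢0 (ℕ.suc m) p with i*j≡0⇒i≡0∨j≡0 (ε * ε - κ) p
      ... | inj₁ q = base≢0 q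
      ... | inj₂ q = power≢0 m q

    -- An eigenvector of A for ±1 with vanishing v-entry is orthogonal to u, so it extends
    -- by 0 to an eigenvector of B for ±1; but B has no such eigenvalue.
    eigenvector-trivial : ∀ ε → ε * ε ≡ + 1 → ∀ {z} → T z ≗ (λ i → ε * z i) → z v ≡ + 0 → ∀ i → z i ≡ + 0
    eigenvector-trivial ε ε² {z} eigen zᵥ≡0 i =
      kernel-trivial (B.resolvent ε) {z₀} (bordered-det≢0 ε ε²) kernel (suc i)
      where
      z₀ : Vec (suc n)
      z₀ zero    = + 0
      z₀ (suc i) = z i
      z-fixed : Fixed z
      z-fixed i = trans (T-cong eigen i) (trans (Σ-cong (λ j → pull (A i j) ε (z j)))
        (trans (Σ-*ˡ ε (λ j → A i j * z j)) (trans (cong (ε *_) (eigen i))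
          (trans (sym (*-assoc ε ε (z i))) (trans (cong (_* z i) ε²) (*-identityˡ (z i)))))))
        where
        pull : ∀ a e z → a * (e * z) ≡ e * (a * z)
        pull = solve-∀
      kernel : ∀ i → (B.resolvent ε ⊛ z₀) i ≡ + 0
      kernel zero    = trans (B.resolvent-⊛ ε z₀ zero)
        (trans (cong (λ t → ε * + 0 - (+ 0 + t)) (trans (col-∙ v z-fixed) (trans (cong ((κ - + 1) *_) zᵥ≡0) (*-zeroʳ (κ - + 1)))))
               (trans (+-identityʳ (ε * + 0)) (*-zeroʳ ε)))
      kernel (suc i) = trans (B.resolvent-⊛ ε z₀ (suc i))
        (trans (cong (λ t → ε * z i - (u i * + 0 + t)) (eigen i)) (cancel (ε * z i) (u i)))
        where
        cancel : ∀ a u → a - (u * + 0 + a) ≡ + 0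
        cancel = solve-∀

    -- The vectors y + Ay and y - Ay are zero or eigenvectors for 1 and -1, and both vanish at `v`.
    -- Hence both are zero, and so is their sum 2y.
    fixed-trivial : ∀ {y} → Fixed y → y v ≡ + 0 → T y v ≡ + 0 → ∀ i → y i ≡ + 0
    fixed-trivial {y} fix yᵥ≡0 Tyᵥ≡0 i = *-cancelˡ-≡ (+ 2) (y i) (+ 0) (trans (halves (y i) (T y i))
        (cong₂ _+_ (component (+ 1) refl i) (component (- + 1) refl i)))
      where
      halves : ∀ y t → + 2 * y ≡ (+ 1 * y + + 1 * t) + (+ 1 * y + - + 1 * t)
      halves = solve-∀
      component : ∀ ε → ε * ε ≡ + 1 → ∀ i → lin (+ 1) y ε (T y) i ≡ + 0
      component ε ε² = eigenvector-trivial ε ε² eigen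
        (trans (cong₂ (λ p q → + 1 * p + ε * q) yᵥ≡0 Tyᵥ≡0) (trans (+-identityˡ (ε * + 0)) (*-zeroʳ ε)))
        where
        eigen : T (lin (+ 1) y ε (T y)) ≗ (λ i → ε * lin (+ 1) y ε (T y) i)
        eigen i = trans (T-lin (+ 1) y ε (T y) i)
          (trans (cong (λ t → + 1 * T y i + ε * t) (fix i))
            (trans (cong (λ t → t * T y i + ε * y i) (sym ε²)) (regroup ε (T y i) (y i))))
          where
          regroup : ∀ e t y → e * e * t + e * y ≡ e * (+ 1 * y + e * t)
          regroup = solve-∀

    -- The remainder of `col c` after subtracting `u c` times `u` and `w c` times `w` lies in V. It
    -- and its image under A both vanish at `v`, because u and Aw have entry 1 there while w has
    -- entry 0.
    col-decomposition : ∀ c i → col c i ≡ u c * u i + w c * w i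
    col-decomposition c i = rearrange (col c i) (u c) (u i) (w c) (w i)
      (fixed-trivial {y} y-fixed yᵥ≡0 Tyᵥ≡0 i)
      where
      rearrange : ∀ m a b c d → + 1 * (+ 1 * m + - a * b) + - c * d ≡ + 0 → m ≡ a * b + c * d
      rearrange m a b c d eq = trans (isolate m a b c d) (trans (cong (λ t → t + (a * b + c * d)) eq) (+-identityˡ _))
        where
        isolate : ∀ m a b c d → m ≡ (+ 1 * (+ 1 * m + - a * b) + - c * d) + (a * b + c * d)
        isolate = solve-∀
      y′ y : Vec n
      y′ = lin (+ 1) (col c) (- u c) u
      y = lin (+ 1) y′ (- w c) w
      y-fixed : Fixed y
      y-fixed = Fixed-lin {y′} {w} (+ 1) (- w c) (Fixed-lin {col c} {u} (+ 1) (- u c) (col-fixed c) u-fixed) w-fixed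
      -- Symmetry of M, obtained by evaluating the dot product of `u` and `col c` in two ways and
      -- cancelling κ - 1. The next identity does the same with `T (col c)`.
      colᵥ : col c v ≡ u c
      colᵥ = *-cancelˡ-≡ (κ - + 1) (col c v) (u c)
        (trans (sym (col-∙ v (col-fixed c))) (trans (∙-comm u (col c)) (col-∙ c u-fixed)))
      Tcolᵥ : T (col c) v ≡ w c
      Tcolᵥ = *-cancelˡ-≡ (κ - + 1) (T (col c) v) (w c)
        (trans (sym (col-∙ v (Fixed-T {col c} (col-fixed c))))
          (trans (∙-comm u (T (col c))) (trans (T-adjoint (col c) u) (col-∙ c w-fixed))))
      yᵥ≡0 : y v ≡ + 0
      yᵥ≡0 = trans (cong₂ (λ p q → + 1 * (+ 1 * p + - u c * q) + - w c * w v) colᵥ uᵥ≡1)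
        (trans (cong (λ t → + 1 * (+ 1 * u c + - u c * + 1) + - w c * t) wᵥ≡0) (cancel (u c) (w c)))
        where
        cancel : ∀ a b → + 1 * (+ 1 * a + - a * + 1) + - b * + 0 ≡ + 0
        cancel = solve-∀
      Tyᵥ≡0 : T y v ≡ + 0
      Tyᵥ≡0 = trans (T-lin (+ 1) y′ (- w c) w v)
        (trans (cong₂ (λ p q → + 1 * p + - w c * q) (T-lin (+ 1) (col c) (- u c) u v) (trans (u-fixed v) uᵥ≡1))
          (trans (cong₂ (λ p q → + 1 * (+ 1 * p + - u c * q) + - w c * + 1) Tcolᵥ wᵥ≡0) (cancel (u c) (w c))))
        where
        cancel : ∀ a b → + 1 * (+ 1 * b + - a * + 0) + - b * + 1 ≡ + 0
        cancel = solve-∀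

    -- The extended signed graph and its degrees.

    module _ (degrees : ∀ i → degree G i ≡ k ⊎ degree G i ℕ.+ 1 ≡ k ⊎ degree G i ℕ.+ 2 ≡ k) where

      -- The diagonal of the decomposition of M: the two squares add up to the deficit of vertex
      -- `i`.
      square-sum : ∀ i → ∃ λ d → d ℕ.≤ 2 × degree G i ℕ.+ d ≡ k × u i * u i + w i * w i ≡ + d
      square-sum i = by-degree (degrees i)
        where
        deficit : ∀ d → d ℕ.≤ 2 → degree G i ℕ.+ d ≡ k →
          ∃ λ d → d ℕ.≤ 2 × degree G i ℕ.+ d ≡ k × u i * u i + w i * w i ≡ + d
        deficit d d≤2 p = d , d≤2 , p , trans (sym (col-decomposition i i)) (col-diagonal i d p)
        by-degree : degree G i ≡ k ⊎ degree G i ℕ.+ 1 ≡ k ⊎ degree G i ℕ.+ 2 ≡ k →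
          ∃ λ d → d ℕ.≤ 2 × degree G i ℕ.+ d ≡ k × u i * u i + w i * w i ≡ + d
        by-degree (inj₁ p)        = deficit 0 ℕ.z≤n (trans (ℕ.+-identityʳ (degree G i)) p)
        by-degree (inj₂ (inj₁ p)) = deficit 1 (ℕ.s≤s ℕ.z≤n) p
        by-degree (inj₂ (inj₂ p)) = deficit 2 ℕ.≤-refl p

      square-sum≤2 : ∀ i → u i * u i + w i * w i ≤ + 2
      square-sum≤2 i = ≤-trans (≤-reflexive (proj₂ (proj₂ (proj₂ (square-sum i))))) (+≤+ (proj₁ (proj₂ (square-sum i))))

      u-entries : ∀ i → Sign₀ (u i)
      u-entries i = summandˡ-Sign₀ (u i) (w i) (square-sum≤2 i)

      w-entries : ∀ i → Sign₀ (w i)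
      w-entries i = summandˡ-Sign₀ (w i) (u i)
        (≤-trans (≤-reflexive (+-comm (w i * w i) (u i * u i))) (square-sum≤2 i))

      H : SignedGraph (suc n)
      adj H = B
      entries H zero    zero    = inj₁ refl
      entries H zero    (suc j) = u-entries j
      entries H (suc i) zero    = u-entries i
      entries H (suc i) (suc j) = entries G i j
      symm H zero    zero    = refl
      symm H zero    (suc j) = refl
      symm H (suc i) zero    = refl
      symm H (suc i) (suc j) = symm G i j
      loopless H zero    = refl
      loopless H (suc i) = loopless G i

      H-spectrum : HasSpectrumH H k (suc j)
      H-spectrum x = trans (charPoly-resolvent B x) (bordered-det x)

      -- The new edge at `i` contributes the square of `u i` to the degree, so of the old deficit
      -- only the square of `w i` remains.
      H-degree-suc : ∀ i → + degree H (suc i) + w i * w i ≡ κ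
      H-degree-suc i = begin
        + degree H (suc i) + w i * w i              ≡⟨ cong (_+ w i * w i) (degree-∙ H (suc i)) ⟩
        u i * u i + A i ∙ A i + w i * w i           ≡⟨ cong (λ t → u i * u i + t + w i * w i) (degree-∙ G i) ⟨
        u i * u i + + degree G i + w i * w i        ≡⟨ regroup (u i * u i) (+ degree G i) (w i * w i) ⟩
        + degree G i + (u i * u i + w i * w i)      ≡⟨ cong (_+_ (+ degree G i)) (proj₂ (proj₂ (proj₂ (square-sum i)))) ⟩
        + degree G i + + d                          ≡⟨ pos-+ (degree G i) d ⟨
        + (degree G i ℕ.+ d)                        ≡⟨ cong +_ (proj₁ (proj₂ (proj₂ (square-sum i)))) ⟩
        κ                                           ∎
        where
        open ≡-Reasoning
        d = proj₁ (square-sum i)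
        regroup : ∀ a b c → a + b + c ≡ b + (a + c)
        regroup = solve-∀

      H-degrees : ∀ i → degree H i ≡ k ⊎ degree H i ℕ.+ 1 ≡ k
      -- The new vertex has degree |u|² = κ - 1.
      H-degrees zero = inj₂ (+-injective (trans (pos-+ (degree H zero) 1) (trans
        (cong (_+ + 1) (trans (degree-∙ H zero) (trans (+-identityˡ (u ∙ u)) u∙u))) (restore κ))))
        where
        restore : ∀ κ → κ - + 1 + + 1 ≡ κ
        restore = solve-∀
      H-degrees (suc i) = Sign₀-deficit (degree H (suc i)) k (w-entries i) (H-degree-suc i)

open import Data.Nat using (_+_; _*_)
open import Data.Fin using (zero)
open import Data.Product using (_,_)
open import Relation.Binary.PropositionalEquality using (refl)

theorem5p4 : (k j : ℕ) (G : SignedGraph (2 * j + 2)) →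
    HasSpectrumG G k j →
    (∀ v → degree G v ≡ k ⊎ degree G v + 1 ≡ k ⊎ degree G v + 2 ≡ k) →
    (∃ λ v → degree G v + 1 ≡ k) →
    Σ (SignedGraph (suc (2 * j + 2))) λ H →
    HasSpectrumH H k (suc j) ×
    (∀ w → degree H w ≡ k ⊎ degree H w + 1 ≡ k) ×
    ∃ λ v → DeletionYields H v G
theorem5p4 k j G spectrum degrees (v , deg-v) =
  -- The added vertex has index `zero`, so `punchIn zero` is `suc` and deleting it returns the
  -- entries of G by computation.
  H v deg-v degrees , H-spectrum v deg-v degrees , H-degrees v deg-v degrees , zero , λ _ _ → refl
  where open Extension G k j spectrum
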